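{- Let $\mathcal{M}=(S,AP,\delta_{\mathcal M},s_{init})$ be a Markov chain and $\mathcal{A}$ a deterministic Rabin automaton over the same set $AP$, such that any two labels $c_1,c_2\in\Sigma=2^{AP}$ with $c_1\sim_{\mathcal A}c_2$ are equal. Let $s$ be an erasable state of $\mathcal M$ with respect to $\mathcal A$, and let $\mathbb E(\mathcal M,s)$ be the erased Markov chain. Then $$\mathbb{P}(\mathcal M\vDash\mathcal A)=\mathbb{P}(\mathbb{E}(\mathcal M,s)\vDash\mathcal A).$$
   Context: Markov chains. $AP$ is a finite set of atomic propositions and $\Sigma=2^{AP}$ is the set of labels. A (transition-labeled) Markov chain (MC) is $\mathcal M=(S,AP,\delta_{\mathcal M},s_{init})$ with $S$ a finite set of states, $s_{init}\in S$, and $\delta_{\mathcal M}\colon S\times\Sigma\times S\to[0,1]\cap\mathbb Q$ such that $\sum_{(c,s_2)}\delta_{\mathcal M}(s_1,c,s_2)=1$ for every $s_1\in S$. An edge is a triple $(s_1,c,s_2)$ with $\delta_{\mathcal M}(s_1,c,s_2)>0$. A (finite or infinite) path is a finite or infinite sequence of edges in which the target of each edge is the source of the next. For a finite path $p$, $\mathrm{head}(p)$ and $\mathrm{last}(p)$ are its first and last states; the trace $\mathrm O(p)$ of a path is the sequence of labels along it. For a finite path $p$, $\mathbb P(p)$ is the product of the probabilities $\delta_{\mathcal M}$ of its edges; this is the measure of the cylinder set $\mathrm{Cyl}(p)$ of infinite paths having $p$ as a prefix. Automata. A deterministic Rabin automaton (DRA) is $\mathcal A=(Q,AP,\Delta,q_{init},Acc)$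 with $Q$ a finite set of positions, $\Delta\colon Q\times\Sigma\to Q$, $q_{init}\in Q$, and $Acc=(L_i,U_i)_{i\in I}\subseteq 2^Q\times 2^Q$. $\Delta$ is extended to words by $\Delta(q,\varepsilon)=q$, $\Delta(q,c\cdot t)=\Delta(\Delta(q,c),t)$. An $\omega$-word is accepted ($\in\mathcal L(\mathcal A)$) if for its run from $q_{init}$ there is $i\in I$ such that some position of $L_i$ occurs infinitely often and every position of $U_i$ occurs only finitely often. Satisfaction probability. $\mathbb P(\mathcal M\vDash\mathcal A)$ is the probability of the set of infinite paths of $\mathcal M$ starting from $s_{init}$ whose trace is in $\mathcal L(\mathcal A)$, under the usual measure determined by cylinder sets. Compatibility. A non-empty word $t\in\Sigma^+$ is acceptance-preserving if for every $q\in Q$, every non-empty prefix $t'$ of $t$, and every $X\in\{L_i,U_i\}$ with $i\in I$: $\Delta(q,t')\in X$ implies $\Delta(q,t)\in X$. For acceptance-preserving words $t_1,t_2$, $t_1\sim_{\mathcal A}t_2$ means $\Delta(q,t_1)=\Delta(q,t_2)$ for all $q\in Q$ (single labels are always acceptance-preserving; $t_1\not\sim_{\mathcal A}t_2$ holds in particular if one of them is not acceptance-preserving). Replaceable edge. An edge $e=(s_e,c_e,s'_e)$ of $\mathcal M$ is replaceable (w.r.t. $\mathcal A$) if $s_e\neq s'_e$ and there is a set $T$ of finite paths of $\mathcal M$, each having $e$ as a prefix, such that: (1) every infinite path that starts with $e$ has a prefix in $T$; (2) for every $p\in T$, $\mathrm O(p)$ is acceptance-preserving and $\mathrm O(p)\sim_{\mathcal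 A}c$ for some $c\in\Sigma$; (3) for every $p\in T$, every strict prefix $p'\neq e$ of $p$ and every $c\in\Sigma$, $\mathrm O(p')\not\sim_{\mathcal A}c$; (4) $e\notin T$; (5) for every $p\in T$, the state $s'_e$ appears only once in $p$. If $e$ is replaceable this set $T$ is unique; it is denoted $MCCS(e,\mathcal A)$. Replaced MC. For a replaceable edge $e=(s_e,c_e,s'_e)$, put $T(c,s)=\{p\in MCCS(e,\mathcal A): \mathrm O(p)\sim_{\mathcal A}c,\ \mathrm{last}(p)=s\}$. Then $\mathbb R(\mathcal M,e)=(S,AP,\delta,s_{init})$ with $\delta(s,c,s')=0$ if $(s,c,s')=e$; $\delta(s,c,s')=\delta_{\mathcal M}(s,c,s')$ if $s\neq s_e$; and $\delta(s,c,s')=\delta_{\mathcal M}(s_e,c,s')+\sum_{p\in T(c,s')}\mathbb P(p)$ otherwise. Erasable state and erased MC. $\mathit{IE}_s$ denotes the set of incoming edges $(s_2,c,s)$ of $s$ in $\mathcal M$. A state $s$ is erasable if $s\neq s_{init}$ and all edges in $\mathit{IE}_s$ are replaceable. For erasable $s$, the erased MC $\mathbb E(\mathcal M,s)$ is obtained from $\mathcal M$ by iteratively applying the replacement $\mathbb R(\cdot,e)$ to each $e\in\mathit{IE}_s$ (the result does not depend on the order) and then deleting the state $s$, which no longer has incoming edges. -}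

module Defs where

open import Axiom.ExcludedMiddle using (ExcludedMiddle)
open import Data.Bool using (if_then_else_)
import Data.Bool.Properties as Bool
open import Data.Fin using (Fin; punchIn; punchOut)
import Data.Fin.Properties as Fin
open import Data.Fin.Subset using (Subset; inside; outside; _∈_)
open import Data.List using (List; []; _∷_; [_]; _++_; map; foldl; foldr; filter; length; allFin; applyUpTo; cartesianProduct; head; last)
import Data.List.Membership.Propositional as List
open import Data.List.Relation.Binary.Prefix.Heterogeneous using (Prefix)
open import Data.List.Relation.Unary.All using (All)
open import Data.List.Relation.Unary.Any using (Any)
open import Data.List.Relation.Unary.Linked using (Linked)
open import Data.List.Relation.Unary.Unique.Propositional using (Unique)
open import Data.Maybe using (Maybe; just; nothing; maybe)
import Data.Maybe as Maybe
import Data.Maybe.Relation.Unary.All as Maybe using (All)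
open import Data.Nat using (ℕ; zero; suc)
import Data.Nat as ℕ
open import Data.Product using (Σ-syntax; ∃-syntax; _×_; _,_; proj₁; proj₂)
open import Data.Product.Properties using (≡-dec)
open import Data.Rational using (ℚ; 0ℚ; 1ℚ; _+_; _*_; _≤_; _<_)
import Data.Rational.Properties as ℚ
import Data.Vec as Vec using ([]; _∷_)
import Data.Vec.Properties as Vec
open import Function.Bundles using (_⇔_)
open import Level using (0ℓ; Lift; lift; lower) renaming (suc to lsuc)
open import Relation.Binary.Definitions using (DecidableEquality)
open import Relation.Binary.PropositionalEquality using (_≡_; _≢_; refl; sym; trans)
open import Relation.Nullary using (¬_; Dec; yes; no; does)
open import Relation.Nullary.Decidable using (map′; _×-dec_)
open import Relation.Unary using (Pred)

sumℚ productℚ : List ℚ → ℚ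
sumℚ     = foldr _+_ 0ℚ
productℚ = foldr _*_ 1ℚ

-- AP is Fin k, so that a label, an element of 2^AP, is a Subset k.

allLabels : ∀ k → List (Subset k)
allLabels zero    = [ Vec.[] ]
allLabels (suc k) =
  map (outside Vec.∷_) (allLabels k) ++ map (inside Vec.∷_) (allLabels k)

Transition : ℕ → ℕ → Set
Transition k n = Fin n × Subset k × Fin n

module _ {k n : ℕ} where

  src tgt : Transition k n → Fin n
  src (s , _ , _)  = s
  tgt (_ , _ , s′) = s′

  label : Transition k n → Subset k
  label (_ , c , _) = c

  infix 4 _≟ₜ_
  _≟ₜ_ : DecidableEquality (Transition k n)
  _≟ₜ_ = ≡-dec Fin._≟_ (≡-dec (Vec.≡-dec Bool._≟_) Fin._≟_)

allTransitions : ∀ k n → List (Transition k n)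
allTransitions k n =
  cartesianProduct (allFin n) (cartesianProduct (allLabels k) (allFin n))

------------------------------------------------------------------------
-- Markov chains

record Chain (k n : ℕ) : Set where
  field
    δ    : Fin n → Subset k → Fin n → ℚ
    init : Fin n

open Chain public

record IsMarkovChain {k n : ℕ} (M : Chain k n) : Set where
  field
    δ-nonneg : ∀ s c s′ → 0ℚ ≤ δ M s c s′
    δ-≤1     : ∀ s c s′ → δ M s c s′ ≤ 1ℚ
    δ-sum    : ∀ s →
      sumℚ (map (λ (c , s′) → δ M s c s′)
                (cartesianProduct (allLabels k) (allFin n))) ≡ 1ℚ

module _ {k n : ℕ} (M : Chain k n) where

  prob : Transition k n → ℚ
  prob (s , c , s′) = δ M s c s′

  IsEdge : Pred (Transition k n) 0ℓ
  IsEdge e = 0ℚ < prob e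

  IsPath : Pred (List (Transition k n)) 0ℓ
  IsPath p = All IsEdge p × Linked (λ e f → tgt e ≡ src f) p

  IsInfinitePath : Pred (ℕ → Transition k n) 0ℓ
  IsInfinitePath π = ∀ i → IsEdge (π i) × tgt (π i) ≡ src (π (suc i))

  pathProb : List (Transition k n) → ℚ
  pathProb p = productℚ (map prob p)

module _ {k n : ℕ} where

  trace : List (Transition k n) → List (Subset k)
  trace = map label

  states : List (Transition k n) → List (Fin n)
  states []      = []
  states (e ∷ p) = src e ∷ tgt e ∷ map tgt p

  occurrences : Fin n → List (Transition k n) → ℕ
  occurrences s p = length (filter (s Fin.≟_) (states p))

infix 4 _⊑_ _⊑ω_

_⊑_ : {A : Set} → List A → List A → Set
_⊑_ = Prefix _≡_

_⊑ω_ : {A : Set} → List A → (ℕ → A) → Set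
p ⊑ω π = p ≡ applyUpTo π (length p)

------------------------------------------------------------------------
-- Deterministic Rabin automata

record DRA (k m : ℕ) : Set where
  field
    Δ     : Fin m → Subset k → Fin m
    qinit : Fin m
    Acc   : List (Subset m × Subset m)

open DRA public

module _ {k m : ℕ} (A : DRA k m) where

  Δ* : Fin m → List (Subset k) → Fin m
  Δ* = foldl (Δ A)

  run : (ℕ → Subset k) → ℕ → Fin m
  run w zero    = qinit A
  run w (suc i) = Δ A (run w i) (w i)

  InfinitelyOften FinitelyOften : (ℕ → Fin m) → Fin m → Set
  InfinitelyOften ρ q = ∀ i → ∃[ j ] i ℕ.≤ j × ρ j ≡ q
  FinitelyOften   ρ q = ∃[ i ] ∀ j → i ℕ.≤ j → ρ j ≢ q

  Accepts : Pred (ℕ → Subset k) 0ℓ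
  Accepts w = Any
    (λ (L , U) → (∃[ q ] q ∈ L × InfinitelyOften (run w) q)
               × (∀ q → q ∈ U → FinitelyOften (run w) q))
    (Acc A)

  record AcceptancePreserving (t : List (Subset k)) : Set where
    field
      nonempty : t ≢ []
      L-preserved : ∀ {L U} → (L , U) List.∈ Acc A →
        ∀ q t′ → t′ ≢ [] → t′ ⊑ t → Δ* q t′ ∈ L → Δ* q t ∈ L
      U-preserved : ∀ {L U} → (L , U) List.∈ Acc A →
        ∀ q t′ → t′ ≢ [] → t′ ⊑ t → Δ* q t′ ∈ U → Δ* q t ∈ U

  infix 4 _∼_
  record _∼_ (t₁ t₂ : List (Subset k)) : Set where
    field
      preserving₁ : AcceptancePreserving t₁
      preserving₂ : AcceptancePreserving t₂
      same-action : ∀ q → Δ* q t₁ ≡ Δ* q t₂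

------------------------------------------------------------------------
-- Satisfaction probability

-- A real number is represented by the set of rationals strictly above it.

Real : Set₁
Real = Pred ℚ 0ℓ

infix 4 _≈ᵣ_
_≈ᵣ_ : Real → Real → Set
x ≈ᵣ y = ∀ r → x r ⇔ y r

module _ {k n : ℕ} (M : Chain k n) where

  InitialPath : Set
  InitialPath =
    Σ[ p ∈ List (Transition k n) ]
      IsPath M p × Maybe.All (λ e → src e ≡ init M) (head p)

  IsInitialInfinitePath : Pred (ℕ → Transition k n) 0ℓ
  IsInitialInfinitePath π = IsInfinitePath M π × src (π 0) ≡ init M

  -- A sequence of cylinder sets; `nothing` is the empty set, so that finite
  -- families are included.

  CylinderSequence : Set
  CylinderSequence = ℕ → Maybe InitialPath

  Covers : CylinderSequence → Pred (ℕ → Transition k n) 0ℓ → Set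
  Covers C E = ∀ π → IsInitialInfinitePath π → E π →
    ∃[ i ] ∃[ p ] C i ≡ just p × proj₁ p ⊑ω π

  cylinderMeasure : Maybe InitialPath → ℚ
  cylinderMeasure = maybe (λ (p , _) → pathProb M p) 0ℚ

  TotalAtMost : CylinderSequence → ℚ → Set
  TotalAtMost C q = ∀ N → sumℚ (applyUpTo (λ i → cylinderMeasure (C i)) N) ≤ q

  -- The Carathéodory construction: the measure determined by the cylinder
  -- sets is, on measurable sets, the infimum of the total weight of countable
  -- covers by cylinders.  It is < r iff some cover has total weight ≤ q < r.

  measure : Pred (ℕ → Transition k n) 0ℓ → Real
  measure E r = ∃[ q ] q < r × ∃[ C ] Covers C E × TotalAtMost C q

-- The set measured here is a Boolean combination of countable intersections
-- of open sets, hence measurable.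

satProb : ∀ {k n m} → Chain k n → DRA k m → Real
satProb M A = measure M (λ π → Accepts A (λ i → label (π i)))

------------------------------------------------------------------------
-- Replaceable edges

module _ {k n m : ℕ} (A : DRA k m) (M : Chain k n) where

  record IsMCCS (e : Transition k n) (T : Pred (List (Transition k n)) 0ℓ) : Set where
    field
      paths      : ∀ p → T p → IsPath M p × [ e ] ⊑ p
      covering   : ∀ π → IsInfinitePath M π → π 0 ≡ e → ∃[ p ] T p × p ⊑ω π
      compatible : ∀ p → T p →
        AcceptancePreserving A (trace p) × ∃[ c ] _∼_ A (trace p) [ c ]
      minimal    : ∀ p → T p → ∀ p′ → p′ ⊑ p → p′ ≢ p → p′ ≢ [ e ] →
        ∀ c → ¬ _∼_ A (trace p′) [ c ]
      nontrivial : ¬ T [ e ]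
      tgt-once   : ∀ p → T p → occurrences (tgt e) p ≡ 1

  Replaceable : Transition k n → Set₁
  Replaceable e = IsEdge M e × src e ≢ tgt e × ∃[ T ] IsMCCS e T

  MCCS : ∀ {e} → Replaceable e → Pred (List (Transition k n)) 0ℓ
  MCCS (_ , _ , T , _) = T

  Erasable : Fin n → Set₁
  Erasable s = s ≢ init M × (∀ e → IsEdge M e → tgt e ≡ s → Replaceable e)

------------------------------------------------------------------------
-- Replacement and erasure

-- The sums over sets of paths below, and the choice of a case on whether an
-- edge is replaceable, are classical.

EM : Set₂
EM = ExcludedMiddle (lsuc 0ℓ)

module _ (em : EM) where

  decide : (P : Set) → Dec P
  decide P = map′ lower lift (em {Lift (lsuc 0ℓ) P})

  -- The sum of f over a finite set P; by convention 0 if P is infinite.  It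
  -- does not depend on the enumeration of P.

  sumOver : {X : Set} → Pred X 0ℓ → (X → ℚ) → ℚ
  sumOver {X} P f
    with decide (Σ[ xs ∈ List X ] Unique xs × (∀ x → x List.∈ xs ⇔ P x))
  ... | yes (xs , _) = sumℚ (map f xs)
  ... | no  _        = 0ℚ

  module _ {k n m : ℕ} (A : DRA k m) where

    -- By König's lemma MCCS is finite when M is a Markov chain, so that the
    -- sum below is a genuine one.

    replace : (M : Chain k n) (e : Transition k n) → Replaceable A M e → Chain k n
    replace M e r = record { δ = δ′ ; init = init M }
      where
      T : Subset k → Fin n → Pred (List (Transition k n)) 0ℓ
      T c s p = MCCS A M r p × _∼_ A (trace p) [ c ] × Maybe.map tgt (last p) ≡ just s

      δ′ : Fin n → Subset k → Fin n → ℚ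
      δ′ s c s′ =
        if does ((s , c , s′) ≟ₜ e) then 0ℚ
        else if does (s Fin.≟ src e)
          then δ M s c s′ + sumOver (T c s′) (pathProb M)
          else δ M s c s′

    -- In the iteration below every edge is still replaceable when its turn
    -- comes, because paths in the MCCS of one incoming edge of an erasable
    -- state use neither another incoming edge nor, after their first edge,
    -- any edge from the source of one.

    replaceIfReplaceable : Chain k n → Transition k n → Chain k n
    replaceIfReplaceable M e with em {Replaceable A M e}
    ... | yes r = replace M e r
    ... | no  _ = M

    replaceAll : Chain k n → List (Transition k n) → Chain k n
    replaceAll = foldl replaceIfReplaceable

    init-replaceAll : ∀ M es → init (replaceAll M es) ≡ init M
    init-replaceAll M []       = refl
    init-replaceAll M (e ∷ es) = trans (init-replaceAll _ es) init-step
      where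
      init-step : init (replaceIfReplaceable M e) ≡ init M
      init-step with em {Replaceable A M e}
      ... | yes _ = refl
      ... | no  _ = refl

incomingEdges : ∀ {k n} → Chain k n → Fin n → List (Transition k n)
incomingEdges {k} {n} M s =
  filter (λ e → (0ℚ ℚ.<? prob M e) ×-dec (tgt e Fin.≟ s)) (allTransitions k n)

-- The remaining states are renumbered by punchOut s.

delete : ∀ {k n} (M : Chain k (suc n)) (s : Fin (suc n)) → s ≢ init M → Chain k n
delete M s s≢init = record
  { δ    = λ x c y → δ M (punchIn s x) c (punchIn s y)
  ; init = punchOut s≢init
  }

erase : EM → ∀ {k n m} (A : DRA k m) (M : Chain k (suc n)) (s : Fin (suc n)) →
        Erasable A M s → Chain k n
erase em A M s (s≢init , _) = delete M′ s s≢init′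
  where
  M′ = replaceAll em A M (incomingEdges M s)

  s≢init′ : s ≢ init M′
  s≢init′ eq = s≢init (trans eq (init-replaceAll em A M (incomingEdges M s)))

{-# OPTIONS --safe #-}
module Submission where

-- Each edge of a replaced or erased chain stands for a finite set of paths of
-- the original chain with the same total probability, and every infinite path
-- of the original chain decomposes uniquely into such paths.  Decomposition
-- preserves acceptance, since each of them is acceptance-preserving and acts
-- as a single label.  A cover of the accepted paths by cylinders is pulled back
-- along the decomposition by lifting each cylinder.  It is pushed forward by
-- taking the cylinders whose preimage is covered, which suffices because, by
-- König's lemma, a path whose whole preimage is covered has such a prefix.

open import Data.Bool using (if_then_else_)
open import Data.Empty using (⊥; ⊥-elim)
open import Data.Fin using (Fin; punchIn; punchOut)
import Data.Fin.Properties as Fin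
open import Data.Fin.Subset using (Subset; inside; outside; _∈_)
open import Data.List using (List; []; _∷_; [_]; _++_; map; filter; length; concat; concatMap; allFin; applyUpTo; cartesianProduct; cartesianProductWith; drop; last)
import Data.List.Properties as List
import Data.List.Membership.Propositional as List
open import Data.List.Membership.Propositional.Properties
open import Data.List.Relation.Binary.Prefix.Heterogeneous using ([]; _∷_; _++ᵖ_)
open import Data.List.Relation.Unary.All as All using (All; []; _∷_)
import Data.List.Relation.Unary.All.Properties as All
import Data.List.Relation.Unary.AllPairs.Properties as AllPairs
open import Data.List.Relation.Unary.Any as Any using (Any; here; there)
open import Data.List.Relation.Unary.Linked using ([]; [-]; _∷_)
open import Data.List.Relation.Unary.Unique.Propositional using (Unique; []; _∷_)
import Data.List.Relation.Unary.Unique.Propositional.Properties as Unique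
open import Data.Maybe using (Maybe; just; nothing; maybe)
import Data.Maybe as Maybe
import Data.Maybe.Properties as Maybe
import Data.Maybe.Relation.Unary.All as Maybe using (All; just; nothing)
open import Data.Nat using (ℕ; zero; suc; z≤n; s≤s)
import Data.Nat as ℕ
import Data.Nat.Properties as ℕ
open import Data.Product using (Σ-syntax; ∃-syntax; _×_; _,_; proj₁; proj₂)
open import Data.Rational using (ℚ; 0ℚ; 1ℚ; _+_; _*_; _≤_; _<_; nonNegative; positive)
import Data.Rational.Properties as ℚ
open import Data.Sum using (_⊎_; inj₁; inj₂)
import Data.Vec as Vec
import Data.Vec.Properties as Vec
open import Function using (_∘_; id; case_of_)
open import Function.Bundles using (_⇔_; mk⇔; Equivalence)
open import Level using (0ℓ)
open import Relation.Binary.PropositionalEquality using (_≡_; _≢_; refl; sym; trans; cong; cong₂; subst; subst₂; module ≡-Reasoning)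
open import Relation.Nullary using (¬_; Dec; yes; no; does)
open import Relation.Nullary.Decidable using (_×-dec_)
open import Relation.Unary using (Pred)
open import Defs

-- The satisfaction probability is an infimum over countable covers, so covers are converted in both
-- directions, keeping every bound on their total weight; all comparisons of weights reduce to
-- finite sums. Pulling back is direct, as the lifts of a path have its probability in total.
-- Pushing forward is the harder direction: a cylinder of the finer chain may end inside a chunk and
-- need not be the preimage of any cylinder of the coarser one. It can still be done because the
-- fibre over one accepted path is compact and consists of accepted paths only. Iterating the
-- replacement raises three further points. The replaced chain must again be a Markov chain, which
-- is read off from the decomposition. The incoming edges not yet treated must stay replaceable. And
-- a path of an MCCS must determine the label of the edge to which it contributes, or its
-- probability would be counted for several edges; this is where the hypothesis on labels enters.

private variable
  X Y : Set

-- Finite sums of rationals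

∑ : List X → (X → ℚ) → ℚ
∑ xs f = sumℚ (map f xs)

∑-cong : ∀ (xs : List X) {f g : X → ℚ} → (∀ x → x List.∈ xs → f x ≡ g x) → ∑ xs f ≡ ∑ xs g
∑-cong []       eq = refl
∑-cong (x ∷ xs) eq = cong₂ _+_ (eq x (here refl)) (∑-cong xs (λ y y∈ → eq y (there y∈)))

∑-mono : ∀ (xs : List X) {f g : X → ℚ} → (∀ x → x List.∈ xs → f x ≤ g x) → ∑ xs f ≤ ∑ xs g
∑-mono []       le = ℚ.≤-refl
∑-mono (x ∷ xs) le = ℚ.+-mono-≤ (le x (here refl)) (∑-mono xs (λ y y∈ → le y (there y∈)))

∑-zero : ∀ (xs : List X) {f : X → ℚ} → (∀ x → x List.∈ xs → f x ≡ 0ℚ) → ∑ xs f ≡ 0ℚ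
∑-zero []       eq = refl
∑-zero (x ∷ xs) eq = cong₂ _+_ (eq x (here refl)) (∑-zero xs (λ y y∈ → eq y (there y∈)))

∑-nonneg : ∀ (xs : List X) {f : X → ℚ} → (∀ x → x List.∈ xs → 0ℚ ≤ f x) → 0ℚ ≤ ∑ xs f
∑-nonneg xs {f} le =
  subst (_≤ ∑ xs f) (∑-zero xs {λ _ → 0ℚ} (λ _ _ → refl)) (∑-mono xs le)

+-interchange : ∀ a b c d → (a + b) + (c + d) ≡ (a + c) + (b + d)
+-interchange a b c d = begin
  (a + b) + (c + d)  ≡⟨ ℚ.+-assoc a b (c + d) ⟩
  a + (b + (c + d))  ≡⟨ cong (a +_) (ℚ.+-assoc b c d) ⟨
  a + ((b + c) + d)  ≡⟨ cong (λ t → a + (t + d)) (ℚ.+-comm b c) ⟩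
  a + ((c + b) + d)  ≡⟨ cong (a +_) (ℚ.+-assoc c b d) ⟩
  a + (c + (b + d))  ≡⟨ ℚ.+-assoc a c (b + d) ⟨
  (a + c) + (b + d)  ∎
  where open ≡-Reasoning

∑-+ : ∀ (xs : List X) (f g : X → ℚ) → ∑ xs (λ x → f x + g x) ≡ ∑ xs f + ∑ xs g
∑-+ []       f g = refl
∑-+ (x ∷ xs) f g = trans (cong (f x + g x +_) (∑-+ xs f g)) (+-interchange (f x) (g x) _ _)

∑-*ˡ : ∀ (xs : List X) c (f : X → ℚ) → ∑ xs (λ x → c * f x) ≡ c * ∑ xs f
∑-*ˡ []       c f = sym (ℚ.*-zeroʳ c)
∑-*ˡ (x ∷ xs) c f = trans (cong (c * f x +_) (∑-*ˡ xs c f)) (sym (ℚ.*-distribˡ-+ c (f x) _))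

∑-*ʳ : ∀ (xs : List X) c (f : X → ℚ) → ∑ xs (λ x → f x * c) ≡ ∑ xs f * c
∑-*ʳ []       c f = sym (ℚ.*-zeroˡ c)
∑-*ʳ (x ∷ xs) c f = trans (cong (f x * c +_) (∑-*ʳ xs c f)) (sym (ℚ.*-distribʳ-+ c (f x) _))

∑-++ : ∀ (xs ys : List X) (f : X → ℚ) → ∑ (xs ++ ys) f ≡ ∑ xs f + ∑ ys f
∑-++ []       ys f = sym (ℚ.+-identityˡ _)
∑-++ (x ∷ xs) ys f = trans (cong (f x +_) (∑-++ xs ys f)) (sym (ℚ.+-assoc (f x) _ _))

∑-concatMap : ∀ (xs : List X) (h : X → List Y) (f : Y → ℚ) →
              ∑ (concatMap h xs) f ≡ ∑ xs (λ x → ∑ (h x) f)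
∑-concatMap []       h f = refl
∑-concatMap (x ∷ xs) h f = trans (∑-++ (h x) _ f) (cong (∑ (h x) f +_) (∑-concatMap xs h f))

∑-map : ∀ (xs : List X) (h : X → Y) (f : Y → ℚ) → ∑ (map h xs) f ≡ ∑ xs (f ∘ h)
∑-map xs h f = cong sumℚ (sym (List.map-∘ xs))

∑-single : ∀ (xs : List X) (f : X → ℚ) {a} → Unique xs → a List.∈ xs →
           (∀ x → x ≢ a → f x ≡ 0ℚ) → ∑ xs f ≡ f a
∑-single (x ∷ xs) f (x∉ ∷ u) (here refl) z =
  trans (cong (f x +_) (∑-zero xs λ y y∈ → z y λ { refl → All.lookup x∉ y∈ refl }))
        (ℚ.+-identityʳ (f x))
∑-single (x ∷ xs) f (x∉ ∷ u) (there a∈) z =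
  trans (cong₂ _+_ (z x (All.lookup x∉ a∈)) (∑-single xs f u a∈ z)) (ℚ.+-identityˡ _)

-- The pointwise form of disjointness: the terms will be indicators of mutually exclusive events, of
-- which at most one is non-zero.
∑-≤1 : ∀ (xs : List X) (f : X → ℚ) → Unique xs →
       (∀ x → x List.∈ xs → f x ≤ 1ℚ) →
       (∀ x y → x List.∈ xs → y List.∈ xs → f x ≢ 0ℚ → f y ≢ 0ℚ → x ≡ y) →
       ∑ xs f ≤ 1ℚ
∑-≤1 []       f u le one = ℚ.nonNegative⁻¹ 1ℚ
∑-≤1 (x ∷ xs) f (x∉ ∷ u) le one with f x ℚ.≟ 0ℚ
... | yes fx≡0 = subst (_≤ 1ℚ) (sym (trans (cong (_+ ∑ xs f) fx≡0) (ℚ.+-identityˡ _)))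
      (∑-≤1 xs f u (λ y y∈ → le y (there y∈)) (λ y z y∈ z∈ → one y z (there y∈) (there z∈)))
... | no fx≢0 = subst (_≤ 1ℚ)
      (sym (trans (cong (f x +_) (∑-zero xs rest)) (ℚ.+-identityʳ (f x)))) (le x (here refl))
  where
  rest : ∀ y → y List.∈ xs → f y ≡ 0ℚ
  rest y y∈ with f y ℚ.≟ 0ℚ
  ... | yes eq = eq
  ... | no ne = ⊥-elim (All.lookup x∉ y∈ (one x y (here refl) (there y∈) fx≢0 ne))

∑-∈-≤ : ∀ (xs : List X) (f : X → ℚ) {a} → (∀ x → x List.∈ xs → 0ℚ ≤ f x) → a List.∈ xs → f a ≤ ∑ xs f
∑-∈-≤ (x ∷ xs) f nn (here refl) =
  subst (_≤ f x + ∑ xs f) (ℚ.+-identityʳ (f x))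
    (ℚ.+-monoʳ-≤ (f x) (∑-nonneg xs (λ y y∈ → nn y (there y∈))))
∑-∈-≤ (x ∷ xs) f nn (there a∈) =
  subst (_≤ f x + ∑ xs f) (ℚ.+-identityˡ (f _))
    (ℚ.+-mono-≤ (nn x (here refl)) (∑-∈-≤ xs f (λ y y∈ → nn y (there y∈)) a∈))

∑-positive : ∀ (xs : List X) (f : X → ℚ) → (∀ x → x List.∈ xs → 0ℚ ≤ f x) → 0ℚ < ∑ xs f →
             ∃[ a ] a List.∈ xs × 0ℚ < f a
∑-positive []       f nn 0<0 = ⊥-elim (ℚ.<-irrefl refl 0<0)
∑-positive (x ∷ xs) f nn 0<∑ with 0ℚ ℚ.<? f x
... | yes 0<fx = x , here refl , 0<fx
... | no  0≮fx with a , a∈ , 0<fa ← ∑-positive xs f (λ y y∈ → nn y (there y∈))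
                   (subst (0ℚ <_) (trans (cong (_+ ∑ xs f) (ℚ.≤-antisym (ℚ.≮⇒≥ 0≮fx) (nn x (here refl))))
                                         (ℚ.+-identityˡ _)) 0<∑)
             = a , there a∈ , 0<fa

*-nonneg : ∀ {a b} → 0ℚ ≤ a → 0ℚ ≤ b → 0ℚ ≤ a * b
*-nonneg {a} {b} 0≤a 0≤b = ℚ.nonNegative⁻¹ (a * b)
  {{ℚ.nonNeg*nonNeg⇒nonNeg a {{nonNegative 0≤a}} b {{nonNegative 0≤b}}}}

*-pos : ∀ {a b} → 0ℚ < a → 0ℚ < b → 0ℚ < a * b
*-pos {a} {b} 0<a 0<b = ℚ.positive⁻¹ (a * b)
  {{ℚ.pos*pos⇒pos a {{positive 0<a}} b {{positive 0<b}}}}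

-- Prefixes of lists and sequences

⊑-refl : ∀ {l : List X} → l ⊑ l
⊑-refl {l = []}    = []
⊑-refl {l = _ ∷ _} = refl ∷ ⊑-refl

⊑-trans : ∀ {l l′ l″ : List X} → l ⊑ l′ → l′ ⊑ l″ → l ⊑ l″
⊑-trans []         q          = []
⊑-trans (refl ∷ p) (refl ∷ q) = refl ∷ ⊑-trans p q

⊑-total : ∀ {l l′ w : List X} → l ⊑ w → l′ ⊑ w → l ⊑ l′ ⊎ l′ ⊑ l
⊑-total []         q          = inj₁ []
⊑-total (p ∷ ps)   []         = inj₂ []
⊑-total (refl ∷ p) (refl ∷ q) with ⊑-total p q
... | inj₁ r = inj₁ (refl ∷ r)
... | inj₂ r = inj₂ (refl ∷ r)

⊑-length-≡ : ∀ {l w : List X} → l ⊑ w → length w ℕ.≤ length l → l ≡ w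
⊑-length-≡ {w = []}    []         _         = refl
⊑-length-≡ (refl ∷ p) (s≤s le) = cong (_ ∷_) (⊑-length-≡ p le)

⊑-++ : ∀ {l : List X} {w} → l ⊑ l ++ w
⊑-++ {w = w} = ⊑-refl ++ᵖ w

++-⊑⁻ˡ : ∀ (a : List X) {b w} → a ++ b ⊑ w → a ⊑ w
++-⊑⁻ˡ a = ⊑-trans ⊑-++

++-⊑⁻ʳ : ∀ (a : List X) {b w} → a ++ b ⊑ w → b ⊑ drop (length a) w
++-⊑⁻ʳ []      p       = p
++-⊑⁻ʳ (x ∷ a) (_ ∷ p) = ++-⊑⁻ʳ a p

-- With the offset on the left of the sum, `shift (suc o) π` is definitionally `shift o (π ∘ suc)`,
-- as the recursion in `⊑ω-++⁺` requires.
shift : ℕ → (ℕ → X) → ℕ → X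
shift o π i = π (o ℕ.+ i)

⊑ω-tail : ∀ {x} {l : List X} {π} → x ∷ l ⊑ω π → x ≡ π 0 × l ⊑ω π ∘ suc
⊑ω-tail eq = List.∷-injective eq

⊑ω-∷ : ∀ {x} {l : List X} {π} → x ≡ π 0 → l ⊑ω π ∘ suc → x ∷ l ⊑ω π
⊑ω-∷ = cong₂ _∷_

⊑ω-cong : ∀ {l : List X} {π ρ} → (∀ i → π i ≡ ρ i) → l ⊑ω π → l ⊑ω ρ
⊑ω-cong {l = []}    eq p = refl
⊑ω-cong {l = x ∷ l} {π} {ρ} eq p with p₁ , p₂ ← ⊑ω-tail {l = l} {π} p =
  ⊑ω-∷ {π = ρ} (trans p₁ (eq 0)) (⊑ω-cong {l = l} (eq ∘ suc) p₂)

⊑ω⇒⊑ : ∀ {l : List X} {π n} → length l ℕ.≤ n → l ⊑ω π → l ⊑ applyUpTo π n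
⊑ω⇒⊑ {l = []}    le p = []
⊑ω⇒⊑ {l = x ∷ l} {π} (s≤s le) p with p₁ , p₂ ← ⊑ω-tail {l = l} {π} p = p₁ ∷ ⊑ω⇒⊑ le p₂

⊑⇒⊑ω : ∀ {l : List X} {π n} → l ⊑ applyUpTo π n → l ⊑ω π
⊑⇒⊑ω {n = zero}  []      = refl
⊑⇒⊑ω {n = suc n} []      = refl
⊑⇒⊑ω {π = π} {n = suc n} (e ∷ p) = ⊑ω-∷ {π = π} e (⊑⇒⊑ω {n = n} p)

⊑-⊑ω : ∀ {l w : List X} {π} → l ⊑ w → w ⊑ω π → l ⊑ω π
⊑-⊑ω {l = l} {w} p q = ⊑⇒⊑ω {n = length w} (subst (l ⊑_) q p)

⊑ω-⊑ : ∀ {l w : List X} {π} → l ⊑ω π → w ⊑ω π → length l ℕ.≤ length w → l ⊑ w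
⊑ω-⊑ {l = l} p q le = subst (l ⊑_) (sym q) (⊑ω⇒⊑ le p)

⊑ω-total : ∀ {l l′ : List X} {π} → l ⊑ω π → l′ ⊑ω π → l ⊑ l′ ⊎ l′ ⊑ l
⊑ω-total {l = l} {l′} p q with ℕ.≤-total (length l) (length l′)
... | inj₁ le = inj₁ (⊑ω-⊑ p q le)
... | inj₂ le = inj₂ (⊑ω-⊑ q p le)

⊑ω-++⁺ : ∀ {a b : List X} {π} → a ⊑ω π → b ⊑ω shift (length a) π → a ++ b ⊑ω π
⊑ω-++⁺ {a = []}    p q = q
⊑ω-++⁺ {a = x ∷ a} {b} {π} p q with p₁ , p₂ ← ⊑ω-tail {l = a} {π} p =
  ⊑ω-∷ {π = π} p₁ (⊑ω-++⁺ {a = a} p₂ q)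

applyUpTo-⊑ω : ∀ (π : ℕ → X) n → applyUpTo π n ⊑ω π
applyUpTo-⊑ω π n = cong (applyUpTo π) (sym (List.length-applyUpTo π n))

length-bound : ∀ (ls : List (List X)) → ∃[ D ] ∀ l → l List.∈ ls → length l ℕ.≤ D
length-bound []       = 0 , λ _ ()
length-bound (l ∷ ls) with D , bd ← length-bound ls = length l ℕ.⊔ D , λ where
  _ (here refl) → ℕ.m≤m⊔n (length l) D
  l′ (there l∈) → ℕ.≤-trans (bd l′ l∈) (ℕ.m≤n⊔m (length l) D)

-- Enumerations

allLabels-complete : ∀ {k} (c : Subset k) → c List.∈ allLabels k
allLabels-complete Vec.[] = here refl
allLabels-complete {suc k} (outside Vec.∷ c) =
  ∈-++⁺ˡ (∈-map⁺ (outside Vec.∷_) (allLabels-complete c))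
allLabels-complete {suc k} (inside Vec.∷ c) =
  ∈-++⁺ʳ (map (outside Vec.∷_) (allLabels k)) (∈-map⁺ (inside Vec.∷_) (allLabels-complete c))

allLabels-unique : ∀ k → Unique (allLabels k)
allLabels-unique zero    = [] ∷ []
allLabels-unique (suc k) = Unique.++⁺
  (Unique.map⁺ Vec.∷-injectiveʳ (allLabels-unique k))
  (Unique.map⁺ Vec.∷-injectiveʳ (allLabels-unique k))
  λ (∈out , ∈in) → clash (∈-map⁻ _ ∈out) (∈-map⁻ _ ∈in)
  where
  clash : ∀ {v : Subset (suc k)} →
    ∃[ x ] x List.∈ allLabels k × v ≡ outside Vec.∷ x →
    ¬ (∃[ y ] y List.∈ allLabels k × v ≡ inside Vec.∷ y)
  clash (_ , _ , refl) (_ , _ , ())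

allSteps : ∀ k n → List (Subset k × Fin n)
allSteps k n = cartesianProduct (allLabels k) (allFin n)

allSteps-complete : ∀ {k n} (c : Subset k) (x : Fin n) → (c , x) List.∈ allSteps k n
allSteps-complete c x = ∈-cartesianProduct⁺ (allLabels-complete c) (∈-allFin x)

allSteps-unique : ∀ k n → Unique (allSteps k n)
allSteps-unique k n = Unique.cartesianProduct⁺ (allLabels-unique k) (Unique.allFin⁺ n)

allTransitions-complete : ∀ {k n} (e : Transition k n) → e List.∈ allTransitions k n
allTransitions-complete (x , c , y) = ∈-cartesianProduct⁺ (∈-allFin x) (allSteps-complete c y)

allTransitions-unique : ∀ k n → Unique (allTransitions k n)
allTransitions-unique k n = Unique.cartesianProduct⁺ (Unique.allFin⁺ n) (allSteps-unique k n)

allLists : List X → ℕ → List (List X)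
allLists xs zero    = [ [] ]
allLists xs (suc d) = cartesianProductWith _∷_ xs (allLists xs d)

allLists-complete : ∀ {xs : List X} → (∀ x → x List.∈ xs) → ∀ l → l List.∈ allLists xs (length l)
allLists-complete all []      = here refl
allLists-complete all (x ∷ l) = ∈-cartesianProductWith⁺ _∷_ (all x) (allLists-complete all l)

allLists-length : ∀ (xs : List X) d {l} → l List.∈ allLists xs d → length l ≡ d
allLists-length xs zero    (here refl) = refl
allLists-length xs (suc d) l∈ with ∈-cartesianProductWith⁻ _∷_ xs (allLists xs d) l∈
... | _ , _ , _ , l∈′ , refl = cong suc (allLists-length xs d l∈′)

allLists-unique : ∀ {xs : List X} → Unique xs → ∀ d → Unique (allLists xs d)
allLists-unique u zero    = [] ∷ []
allLists-unique u (suc d) =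
  Unique.cartesianProductWith⁺ _∷_ List.∷-injective u (allLists-unique u d)

-- Takes the maximum of the individual bounds. This is the pigeonhole principle behind König's lemma
-- and behind the recurrence of automaton positions.
uniform : (xs : List X) (P : X → ℕ → Set) → (∀ {x d d′} → d ℕ.≤ d′ → P x d → P x d′) →
          (∀ x → ∃[ d ] P x d) → ∃[ d ] ∀ x → x List.∈ xs → P x d
uniform []       P mono ex = 0 , λ _ ()
uniform (x ∷ xs) P mono ex with d , p ← ex x | D , q ← uniform xs P mono ex = d ℕ.⊔ D , λ where
  _ (here refl) → mono (ℕ.m≤m⊔n d D) p
  y (there y∈)  → mono (ℕ.m≤n⊔m d D) (q y y∈)

-- Classical reasoning and König's lemma

module Classical (em : EM) where

  decide′ : (P : Set) → Dec P
  decide′ = decide em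

  byContradiction : {P : Set} → ¬ ¬ P → P
  byContradiction {P} ¬¬p with decide′ P
  ... | yes p = p
  ... | no ¬p = ⊥-elim (¬¬p ¬p)

  ¬∀⇒∃¬ : {P : X → Set} → ¬ (∀ x → P x) → ∃[ x ] ¬ P x
  ¬∀⇒∃¬ ¬∀ = byContradiction λ ¬∃ → ¬∀ λ x → byContradiction λ ¬p → ¬∃ (x , ¬p)

  least : {P : ℕ → Set} → ∀ d → (∃[ i ] i ℕ.≤ d × P i) → ∃[ i ] P i × (∀ j → j ℕ.< i → ¬ P j)
  least     zero    (_ , z≤n , p) = 0 , p , λ _ ()
  least {P} (suc d) (i , i≤1+d , p) with decide′ (∃[ j ] j ℕ.≤ d × P j)
  ... | yes q = least d q
  ... | no ¬q = i , p , λ j j<i q → ¬q (j , ℕ.≤-pred (ℕ.≤-trans j<i i≤1+d) , q)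

  module _ {X : Set} (xs : List X) (all : ∀ x → x List.∈ xs)
    (B : ℕ → Pred (ℕ → X) 0ℓ) (B-anti : ∀ {d d′ π} → d ℕ.≤ d′ → B d′ π → B d π)
    (inhabited : ∀ d → ∃[ π ] B d π) where

    private
      Live : List X → Set
      Live w = ∀ d → ∃[ ρ ] B d ρ × w ⊑ω ρ

      -- If every one-letter extension failed at some stage, all would fail at a common stage `d`;
      -- but the member of `B d` that extends `w` continues with some letter.
      extend : ∀ w → Live w → ∃[ x ] Live (w ++ [ x ])
      extend w live = byContradiction λ ¬∃ →
        let P : X → ℕ → Set
            P x d = ¬ (∃[ ρ ] B d ρ × (w ++ [ x ]) ⊑ω ρ)
            d , none = uniform xs P
              (λ d≤d′ ¬p (ρ , b , q) → ¬p (ρ , B-anti d≤d′ b , q))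
              (λ x → ¬∀⇒∃¬ λ live′ → ¬∃ (x , live′))
            ρ , b , q = live d
        in none (ρ (length w)) (all _)
             (ρ , b , ⊑ω-snoc w q)
        where
        ⊑ω-snoc : ∀ w {ρ : ℕ → X} → w ⊑ω ρ → (w ++ [ ρ (length w) ]) ⊑ω ρ
        ⊑ω-snoc []      q = refl
        ⊑ω-snoc (x ∷ w) {ρ} q with q₁ , q₂ ← ⊑ω-tail {l = w} {ρ} q =
          ⊑ω-∷ {π = ρ} q₁ (⊑ω-snoc w q₂)

      grow : ℕ → Σ[ w ∈ List X ] Live w
      grow zero    = [] , λ d → let ρ , b = inhabited d in ρ , b , refl
      grow (suc j) = let w , live = grow j ; x , live′ = extend w live in w ++ [ x ] , live′

      limit : ℕ → X
      limit j = proj₁ (extend (proj₁ (grow j)) (proj₂ (grow j)))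

      grow-limit : ∀ j → proj₁ (grow j) ≡ applyUpTo limit j
      grow-limit zero    = refl
      grow-limit (suc j) =
        trans (cong (_++ [ limit j ]) (grow-limit j)) (List.applyUpTo-∷ʳ limit j)

    abstract
      -- The sets `B d` need not be closed, so the limit may lie in none of them. What survives is
      -- that each finite prefix of it is shared with members of every `B d`.
      koenig : ∃[ π ] ∀ j d → ∃[ ρ ] B d ρ × applyUpTo π j ⊑ω ρ
      koenig = limit , λ j d → subst (λ w → ∃[ ρ ] B d ρ × w ⊑ω ρ) (grow-limit j) (proj₂ (grow j) d)

-- Paths and their expectation

module _ {k n : ℕ} where

  -- Zero whenever `w` is shorter than `l`, so the indicator of a cylinder is faithful only at
  -- depths of at least `length l`. Hence the length bounds on expectations below.
  ind : List (Transition k n) → List (Transition k n) → ℚ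
  ind []      w       = 1ℚ
  ind (a ∷ l) []      = 0ℚ
  ind (a ∷ l) (b ∷ w) with a ≟ₜ b
  ... | yes _ = ind l w
  ... | no  _ = 0ℚ

  ind-⊑ : ∀ {l w} → l ⊑ w → ind l w ≡ 1ℚ
  ind-⊑ []             = refl
  ind-⊑ {a ∷ l} (refl ∷ p) with a ≟ₜ a
  ... | yes _  = ind-⊑ p
  ... | no a≢a = ⊥-elim (a≢a refl)

  ind-⋢ : ∀ l w → ind l w ≢ 0ℚ → l ⊑ w
  ind-⋢ []      w       ne = []
  ind-⋢ (a ∷ l) []      ne = ⊥-elim (ne refl)
  ind-⋢ (a ∷ l) (b ∷ w) ne with a ≟ₜ b
  ... | yes a≡b = a≡b ∷ ind-⋢ l w ne
  ... | no  _   = ⊥-elim (ne refl)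

  ind-nonneg : ∀ l w → 0ℚ ≤ ind l w
  ind-nonneg []      w       = ℚ.nonNegative⁻¹ 1ℚ
  ind-nonneg (a ∷ l) []      = ℚ.≤-refl
  ind-nonneg (a ∷ l) (b ∷ w) with a ≟ₜ b
  ... | yes _ = ind-nonneg l w
  ... | no  _ = ℚ.≤-refl

  ind-≤1 : ∀ l w → ind l w ≤ 1ℚ
  ind-≤1 []      w       = ℚ.≤-refl
  ind-≤1 (a ∷ l) []      = ℚ.nonNegative⁻¹ 1ℚ
  ind-≤1 (a ∷ l) (b ∷ w) with a ≟ₜ b
  ... | yes _ = ind-≤1 l w
  ... | no  _ = ℚ.nonNegative⁻¹ 1ℚ

  ind-++ : ∀ a b w → ind (a ++ b) w ≡ ind a w * ind b (drop (length a) w)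
  ind-++ []      b w       = sym (ℚ.*-identityˡ (ind b w))
  ind-++ (x ∷ a) b []      = sym (ℚ.*-zeroˡ (ind b []))
  ind-++ (x ∷ a) b (y ∷ w) with x ≟ₜ y
  ... | yes _ = ind-++ a b w
  ... | no  _ = sym (ℚ.*-zeroˡ (ind b (drop (length a) w)))

  endState : Fin n → List (Transition k n) → Fin n
  endState x []      = x
  endState x (e ∷ p) = endState (tgt e) p

module _ {k n : ℕ} (M : Chain k n) where

  -- The start state is an index, so that the empty path has one too and concatenation needs no
  -- separate case for it.
  data PathFrom : Fin n → List (Transition k n) → Set where
    []  : ∀ {x} → PathFrom x []
    _∷_ : ∀ {e p} → IsEdge M e → PathFrom (tgt e) p → PathFrom (src e) (e ∷ p)

module _ {k n : ℕ} {M : Chain k n} where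

  PathFrom⇒IsPath : ∀ {x p} → PathFrom M x p → IsPath M p
  PathFrom⇒IsPath []                = [] , []
  PathFrom⇒IsPath (e ∷ [])          = (e ∷ []) , [-]
  PathFrom⇒IsPath (e ∷ (f ∷ p)) with es , ls ← PathFrom⇒IsPath (f ∷ p) = (e ∷ es) , (refl ∷ ls)

  IsPath⇒PathFrom : ∀ {e p} → IsPath M (e ∷ p) → PathFrom M (src e) (e ∷ p)
  IsPath⇒PathFrom {p = []}    (e ∷ [] , _)       = e ∷ []
  IsPath⇒PathFrom {e} {p = f ∷ p} (pe ∷ es , l ∷ ls) =
    pe ∷ subst (λ x → PathFrom M x (f ∷ p)) (sym l) (IsPath⇒PathFrom (es , ls))

  PathFrom-src : ∀ {x e p} → PathFrom M x (e ∷ p) → src e ≡ x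
  PathFrom-src (_ ∷ _) = refl

  PathFrom-++⁺ : ∀ {x p q} → PathFrom M x p → PathFrom M (endState x p) q → PathFrom M x (p ++ q)
  PathFrom-++⁺ []       q = q
  PathFrom-++⁺ (e ∷ p) q = e ∷ PathFrom-++⁺ p q

  IsInfinitePath-suc : ∀ {π} → IsInfinitePath M π → IsInfinitePath M (π ∘ suc)
  IsInfinitePath-suc path i = path (suc i)

  IsInfinitePath-shift : ∀ {π} o → IsInfinitePath M π → IsInfinitePath M (shift o π)
  IsInfinitePath-shift {π} o path i =
    proj₁ (path (o ℕ.+ i)) ,
    trans (proj₂ (path (o ℕ.+ i))) (cong (src ∘ π) (sym (ℕ.+-suc o i)))

  ⊑ω-PathFrom : ∀ {p π} → IsInfinitePath M π → p ⊑ω π → PathFrom M (src (π 0)) p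
  ⊑ω-PathFrom {[]}    path q = []
  ⊑ω-PathFrom {e ∷ p} {π} path q with refl , q₂ ← ⊑ω-tail {l = p} {π} q =
    proj₁ (path 0) ∷ subst (λ x → PathFrom M x p) (sym (proj₂ (path 0)))
                        (⊑ω-PathFrom (IsInfinitePath-suc path) q₂)

  endState-⊑ω : ∀ {p π} → IsInfinitePath M π → p ⊑ω π →
                endState (src (π 0)) p ≡ src (π (length p))
  endState-⊑ω {[]}    path q = refl
  endState-⊑ω {e ∷ p} {π} path q with refl , q₂ ← ⊑ω-tail {l = p} {π} q =
    trans (cong (λ x → endState x p) (proj₂ (path 0))) (endState-⊑ω (IsInfinitePath-suc path) q₂)

module Markov {k n : ℕ} (M : Chain k n) (mc : IsMarkovChain M) where
  open IsMarkovChain mc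

  prob-nonneg : ∀ e → 0ℚ ≤ prob M e
  prob-nonneg (x , c , y) = δ-nonneg x c y

  pathProb-nonneg : ∀ p → 0ℚ ≤ pathProb M p
  pathProb-nonneg []      = ℚ.nonNegative⁻¹ 1ℚ
  pathProb-nonneg (e ∷ p) = *-nonneg (prob-nonneg e) (pathProb-nonneg p)

  outEdge : ∀ x → ∃[ e ] src e ≡ x × IsEdge M e
  outEdge x with (c , y) , _ , pos ← ∑-positive (allSteps k n) (λ (c , y) → δ M x c y)
                   (λ (c , y) _ → δ-nonneg x c y)
                   (subst (0ℚ <_) (sym (δ-sum x)) (ℚ.positive⁻¹ 1ℚ))
    = (x , c , y) , refl , pos

  canonical : Fin n → ℕ → Transition k n
  canonical x zero    = proj₁ (outEdge x)
  canonical x (suc i) = canonical (tgt (proj₁ (outEdge x))) i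

  canonical-path : ∀ x → IsInfinitePath M (canonical x) × src (canonical x 0) ≡ x
  canonical-path x = go x , proj₁ (proj₂ (outEdge x))
    where
    go : ∀ x → IsInfinitePath M (canonical x)
    go x zero    = proj₂ (proj₂ (outEdge x)) , sym (proj₁ (proj₂ (outEdge _)))
    go x (suc i) = go _ i

  infix 5 _▸_
  _▸_ : List (Transition k n) → (ℕ → Transition k n) → ℕ → Transition k n
  ([]      ▸ π) i       = π i
  ((e ∷ p) ▸ π) zero    = e
  ((e ∷ p) ▸ π) (suc i) = (p ▸ π) i

  ⊑ω-▸ : ∀ p π → p ⊑ω (p ▸ π)
  ⊑ω-▸ []      π = refl
  ⊑ω-▸ (e ∷ p) π = cong (e ∷_) (⊑ω-▸ p π)

  ▸-path : ∀ {x p π} → PathFrom M x p → IsInfinitePath M π → src (π 0) ≡ endState x p →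
           IsInfinitePath M (p ▸ π) × src ((p ▸ π) 0) ≡ x
  ▸-path []      path eq = path , eq
  ▸-path {p = e ∷ p} (pe ∷ pp) path eq with path′ , start ← ▸-path pp path eq =
    (λ { zero → pe , sym start ; (suc i) → path′ i }) , refl

  -- Covers and the covering condition of an MCCS speak of infinite paths, so a finite path has to
  -- be prolonged before they apply. This is possible since the outgoing probabilities of each state
  -- sum to one.
  infinite-extension : ∀ {x p} → PathFrom M x p →
    ∃[ π ] IsInfinitePath M π × src (π 0) ≡ x × p ⊑ω π
  infinite-extension {x} {p} pp
    with path , start ← canonical-path (endState x p)
    with path′ , start′ ← ▸-path pp path start = _ , path′ , start′ , ⊑ω-▸ p _

  -- The expectation of g over the first D edges of a random path from x.
  -- Inequalities between total weights of cylinders follow from pointwise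
  -- inequalities between sums of the indicators ind.
  E : ℕ → Fin n → (List (Transition k n) → ℚ) → ℚ
  E zero    x g = g []
  E (suc D) x g = ∑ (allSteps k n) λ (c , y) → δ M x c y * E D y (λ w → g ((x , c , y) ∷ w))

  -- Transitions that are not edges carry the factor zero, so the comparison is demanded on genuine
  -- paths of length `D` only.
  E-mono : ∀ D x {g h} → (∀ w → PathFrom M x w → length w ≡ D → g w ≤ h w) → E D x g ≤ E D x h
  E-mono zero    x le = le [] [] refl
  E-mono (suc D) x {g} {h} le = ∑-mono (allSteps k n) λ (c , y) _ → step c y
    where
    step : ∀ c y → δ M x c y * E D y (λ w → g ((x , c , y) ∷ w)) ≤
                   δ M x c y * E D y (λ w → h ((x , c , y) ∷ w))
    step c y with 0ℚ ℚ.<? δ M x c y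
    ... | yes pos = ℚ.*-monoˡ-≤-nonNeg (δ M x c y) {{nonNegative (δ-nonneg x c y)}}
                      (E-mono D y λ w pw eq → le _ (pos ∷ pw) (cong suc eq))
    ... | no ¬pos = ℚ.≤-reflexive (trans (zero* _) (sym (zero* _)))
      where
      zero* : ∀ q → δ M x c y * q ≡ 0ℚ
      zero* q = trans (cong (_* q) (ℚ.≤-antisym (ℚ.≮⇒≥ ¬pos) (δ-nonneg x c y))) (ℚ.*-zeroˡ q)

  E-cong : ∀ D x {g h} → (∀ w → PathFrom M x w → length w ≡ D → g w ≡ h w) → E D x g ≡ E D x h
  E-cong D x eq = ℚ.≤-antisym (E-mono D x λ w p l → ℚ.≤-reflexive (eq w p l))
                              (E-mono D x λ w p l → ℚ.≤-reflexive (sym (eq w p l)))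

  E-const : ∀ D x r → E D x (λ _ → r) ≡ r
  E-const zero    x r = refl
  E-const (suc D) x r = begin
    ∑ (allSteps k n) (λ (c , y) → δ M x c y * E D y (λ _ → r))
      ≡⟨ ∑-cong (allSteps k n) (λ (c , y) _ → cong (δ M x c y *_) (E-const D y r)) ⟩
    ∑ (allSteps k n) (λ (c , y) → δ M x c y * r)
      ≡⟨ ∑-*ʳ (allSteps k n) r _ ⟩
    ∑ (allSteps k n) (λ (c , y) → δ M x c y) * r
      ≡⟨ cong (_* r) (δ-sum x) ⟩
    1ℚ * r
      ≡⟨ ℚ.*-identityˡ r ⟩
    r ∎
    where open ≡-Reasoning

  E-+ : ∀ D x g h → E D x (λ w → g w + h w) ≡ E D x g + E D x h
  E-+ zero    x g h = refl
  E-+ (suc D) x g h = trans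
    (∑-cong (allSteps k n) λ (c , y) _ →
       trans (cong (δ M x c y *_) (E-+ D y _ _)) (ℚ.*-distribˡ-+ (δ M x c y) _ _))
    (∑-+ (allSteps k n) _ _)

  E-∑ : ∀ D x (as : List X) (f : X → List (Transition k n) → ℚ) →
        E D x (λ w → ∑ as (λ a → f a w)) ≡ ∑ as (λ a → E D x (f a))
  E-∑ D x []       f = E-const D x 0ℚ
  E-∑ D x (a ∷ as) f = trans (E-+ D x (f a) _) (cong (E D x (f a) +_) (E-∑ D x as f))

  E-ind : ∀ D x l → PathFrom M x l → length l ℕ.≤ D → E D x (ind l) ≡ pathProb M l
  E-ind D       x []              p         le       = E-const D x 1ℚ
  E-ind (suc D) x ((_ , c , y) ∷ l) (e ∷ p) (s≤s le) = begin
    ∑ (allSteps k n) term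
      ≡⟨ ∑-single (allSteps k n) term (allSteps-unique k n) (allSteps-complete c y) other ⟩
    term (c , y)
      ≡⟨ cong (δ M x c y *_) (E-cong D y λ w _ _ → same w) ⟩
    δ M x c y * E D y (ind l)
      ≡⟨ cong (δ M x c y *_) (E-ind D y l p le) ⟩
    δ M x c y * pathProb M l ∎
    where
    open ≡-Reasoning
    term : Subset k × Fin n → ℚ
    term (c′ , y′) = δ M x c′ y′ * E D y′ (λ w → ind ((x , c , y) ∷ l) ((x , c′ , y′) ∷ w))

    same : ∀ w → ind ((x , c , y) ∷ l) ((x , c , y) ∷ w) ≡ ind l w
    same w with (x , c , y) ≟ₜ (x , c , y)
    ... | yes _ = refl
    ... | no ne = ⊥-elim (ne refl)

    diff : ∀ {c′ y′} w → (c′ , y′) ≢ (c , y) → ind ((x , c , y) ∷ l) ((x , c′ , y′) ∷ w) ≡ 0ℚ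
    diff {c′} {y′} w ne with (x , c , y) ≟ₜ (x , c′ , y′)
    ... | yes refl = ⊥-elim (ne refl)
    ... | no _     = refl

    other : ∀ s → s ≢ (c , y) → term s ≡ 0ℚ
    other (c′ , y′) ne = trans
      (cong (δ M x c′ y′ *_) (trans (E-cong D y′ λ w _ _ → diff w ne) (E-const D y′ 0ℚ)))
      (ℚ.*-zeroʳ (δ M x c′ y′))

∑-≢0 : ∀ (xs : List X) (f : X → ℚ) → ∑ xs f ≢ 0ℚ → ∃[ x ] x List.∈ xs × f x ≢ 0ℚ
∑-≢0 []       f ne = ⊥-elim (ne refl)
∑-≢0 (x ∷ xs) f ne with f x ℚ.≟ 0ℚ
... | no fx≢0 = x , here refl , fx≢0
... | yes fx≡0 with y , y∈ , fy≢0 ← ∑-≢0 xs f (λ eq → ne (cong₂ _+_ fx≡0 eq)) = y , there y∈ , fy≢0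

*-≢0ˡ : ∀ {a} b → a * b ≢ 0ℚ → a ≢ 0ℚ
*-≢0ˡ b ne refl = ne (ℚ.*-zeroˡ b)

*-≤1 : ∀ {a b} → 0ℚ ≤ a → a ≤ 1ℚ → b ≤ 1ℚ → a * b ≤ 1ℚ
*-≤1 {a} {b} 0≤a a≤1 b≤1 = ℚ.≤-trans
  (subst (a * b ≤_) (ℚ.*-identityʳ a) (ℚ.*-monoˡ-≤-nonNeg a {{nonNegative 0≤a}} b≤1)) a≤1

-- Refinements of Markov chains

trace-⊑ω : ∀ {k n} {l : List (Transition k n)} {π} → l ⊑ω π → trace l ⊑ω label ∘ π
trace-⊑ω {l = []}    p = refl
trace-⊑ω {l = e ∷ l} {π} p with refl , p₂ ← ⊑ω-tail {l = l} {π} p =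
  ⊑ω-∷ {π = label ∘ π} refl (trace-⊑ω {l = l} p₂)

pathProb-++ : ∀ {k n} (M : Chain k n) p q → pathProb M (p ++ q) ≡ pathProb M p * pathProb M q
pathProb-++ M []      q = sym (ℚ.*-identityˡ _)
pathProb-++ M (e ∷ p) q = trans (cong (prob M e *_) (pathProb-++ M p q)) (sym (ℚ.*-assoc (prob M e) _ _))

pathProb-pos : ∀ {k n} {M : Chain k n} {x p} → PathFrom M x p → 0ℚ < pathProb M p
pathProb-pos []      = ℚ.positive⁻¹ 1ℚ
pathProb-pos (e ∷ p) = *-pos e (pathProb-pos p)

-- M is a refinement of M′: each edge of M′ stands for the paths of M in its
-- fibre, into which every infinite path of M decomposes uniquely.
record Refinement {k m n n′ : ℕ} (A : DRA k m) (M : Chain k n) (M′ : Chain k n′) : Set where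
  field
    h            : Fin n′ → Fin n
    h-init       : h (init M′) ≡ init M
    fibre        : Transition k n′ → List (List (Transition k n))
    fibre-unique : ∀ f → Unique (fibre f)
    fibre-path   : ∀ {f l} → l List.∈ fibre f → PathFrom M (h (src f)) l
    fibre-end    : ∀ {f l} → l List.∈ fibre f → endState (h (src f)) l ≡ h (tgt f)
    fibre-∼      : ∀ {f l} → l List.∈ fibre f → _∼_ A (trace l) [ label f ]
    fibre-prob   : ∀ f → prob M′ f ≡ ∑ (fibre f) (pathProb M)
    prefix-free  : ∀ {f g a b} → a List.∈ fibre f → b List.∈ fibre g → src f ≡ src g →
                   a ⊑ b → a ≡ b × f ≡ g
    first-chunk  : ∀ {π} x → IsInfinitePath M π → src (π 0) ≡ h x →
                   ∃[ f ] src f ≡ x × ∃[ l ] l List.∈ fibre f × l ⊑ω π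

module Refine (em : EM) {k m n n′ : ℕ} {A : DRA k m} {M : Chain k n} {M′ : Chain k n′}
              (mc : IsMarkovChain M) (R : Refinement A M M′) where
  open Refinement R
  open Markov M mc
  open Classical em

  prefix-free-⊑ : ∀ {f g a b w} → a List.∈ fibre f → b List.∈ fibre g → src f ≡ src g →
                  a ⊑ w → b ⊑ w → a ≡ b × f ≡ g
  prefix-free-⊑ a∈ b∈ eq p q with ⊑-total p q
  ... | inj₁ a⊑b = prefix-free a∈ b∈ eq a⊑b
  ... | inj₂ b⊑a with refl , refl ← prefix-free b∈ a∈ (sym eq) b⊑a = refl , refl

  fibre⇒edge : ∀ {f l} → l List.∈ fibre f → IsEdge M′ f
  fibre⇒edge {f} l∈ = subst (0ℚ <_) (sym (fibre-prob f)) (ℚ.<-≤-trans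
    (pathProb-pos (fibre-path l∈)) (∑-∈-≤ (fibre f) (pathProb M) (λ p _ → pathProb-nonneg p) l∈))

  lifts : List (Transition k n′) → List (List (Transition k n))
  lifts []      = [ [] ]
  lifts (f ∷ p) = concatMap (λ a → map (a ++_) (lifts p)) (fibre f)

  ∈-lifts⁺ : ∀ f p {a b} → a List.∈ fibre f → b List.∈ lifts p → a ++ b List.∈ lifts (f ∷ p)
  ∈-lifts⁺ f p {a} a∈ b∈ =
    ∈-concatMap⁺ (λ a → map (a ++_) (lifts p)) (List.lose a∈ (∈-map⁺ (a ++_) b∈))

  ∈-lifts⁻ : ∀ {f p l} → l List.∈ lifts (f ∷ p) →
             ∃[ a ] ∃[ b ] a List.∈ fibre f × b List.∈ lifts p × l ≡ a ++ b
  ∈-lifts⁻ {f} {p} l∈ with a , a∈ , l∈′ ← List.find (∈-concatMap⁻ (λ a → map (a ++_) (lifts p)) {fibre f} l∈)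
    with b , b∈ , eq ← ∈-map⁻ (a ++_) l∈′ = a , b , a∈ , b∈ , eq

  lifts-path : ∀ {x p l} → PathFrom M′ x p → l List.∈ lifts p → PathFrom M (h x) l
  lifts-path []      (here refl) = []
  lifts-path {p = f ∷ p} (e ∷ pp) l∈ with a , b , a∈ , b∈ , refl ← ∈-lifts⁻ {f} {p} l∈ =
    PathFrom-++⁺ (fibre-path a∈)
      (subst (λ y → PathFrom M y b) (sym (fibre-end a∈)) (lifts-path pp b∈))

  ∑-lifts : ∀ f p (g : List (Transition k n) → ℚ) →
            ∑ (lifts (f ∷ p)) g ≡ ∑ (fibre f) (λ a → ∑ (lifts p) (λ b → g (a ++ b)))
  ∑-lifts f p g = trans (∑-concatMap (fibre f) _ g)
    (∑-cong (fibre f) λ a _ → ∑-map (lifts p) (a ++_) g)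

  -- Distributivity: the product over the edges of `p` of the sums over their fibres expands into a
  -- sum over all choices of one chunk per edge.
  lifts-prob : ∀ p → ∑ (lifts p) (pathProb M) ≡ pathProb M′ p
  lifts-prob []      = refl
  lifts-prob (f ∷ p) = begin
    ∑ (lifts (f ∷ p)) (pathProb M)
      ≡⟨ ∑-lifts f p (pathProb M) ⟩
    ∑ (fibre f) (λ a → ∑ (lifts p) (λ b → pathProb M (a ++ b)))
      ≡⟨ ∑-cong (fibre f) (λ a _ → trans (∑-cong (lifts p) λ b _ → pathProb-++ M a b)
                                         (∑-*ˡ (lifts p) (pathProb M a) (pathProb M))) ⟩
    ∑ (fibre f) (λ a → pathProb M a * ∑ (lifts p) (pathProb M))
      ≡⟨ ∑-*ʳ (fibre f) _ (pathProb M) ⟩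
    ∑ (fibre f) (pathProb M) * ∑ (lifts p) (pathProb M)
      ≡⟨ cong₂ _*_ (sym (fibre-prob f)) (lifts-prob p) ⟩
    prob M′ f * pathProb M′ p ∎
    where open ≡-Reasoning

  lifts-⊑ : ∀ {p q l} → p ⊑ q → l List.∈ lifts q → ∃[ l′ ] l′ List.∈ lifts p × l′ ⊑ l
  lifts-⊑ []         l∈ = [] , here refl , []
  lifts-⊑ {f ∷ p} {f ∷ q} (refl ∷ r) l∈ with a , b , a∈ , b∈ , refl ← ∈-lifts⁻ {f} {q} l∈
    with b′ , b′∈ , b′⊑b ← lifts-⊑ r b∈ =
    a ++ b′ , ∈-lifts⁺ f p a∈ b′∈ , ++-⊑ a b′⊑b
    where
    ++-⊑ : ∀ a {b b′ : List (Transition k n)} → b′ ⊑ b → a ++ b′ ⊑ a ++ b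
    ++-⊑ []      r = r
    ++-⊑ (x ∷ a) r = refl ∷ ++-⊑ a r

  -- Both words have their first chunk as a prefix of `w`, so prefix-freeness identifies these
  -- chunks and their edges; the comparison continues after the common chunk.
  unique-parse : ∀ {x p q l₁ l₂ w} → PathFrom M′ x p → PathFrom M′ x q →
                 l₁ List.∈ lifts p → l₂ List.∈ lifts q → l₁ ⊑ w → l₂ ⊑ w → p ⊑ q ⊎ q ⊑ p
  unique-parse []      q       _  _  _ _ = inj₁ []
  unique-parse (e ∷ p) []      _  _  _ _ = inj₂ []
  unique-parse {p = f ∷ p} {q = g ∷ q} pp qq l₁∈ l₂∈ r s
    with a , b , a∈ , b∈ , refl ← ∈-lifts⁻ {f} {p} l₁∈
    with a′ , b′ , a′∈ , b′∈ , refl ← ∈-lifts⁻ {g} {q} l₂∈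
    with refl , refl ← prefix-free-⊑ a∈ a′∈ (trans (PathFrom-src pp) (sym (PathFrom-src qq)))
                         (++-⊑⁻ˡ a r) (++-⊑⁻ˡ a′ s)
    with _ ∷ pp′ ← pp | _ ∷ qq′ ← qq
    with unique-parse pp′ qq′ b∈ b′∈ (++-⊑⁻ʳ a r) (++-⊑⁻ʳ a s)
  ... | inj₁ t = inj₁ (refl ∷ t)
  ... | inj₂ t = inj₂ (refl ∷ t)

  -- Counts the lifts of `p` with which `w` starts. Prefix-freeness bounds the count by one, so for
  -- long `w` it is the indicator that the decomposition of `w` starts with `p`.
  parses : List (Transition k n′) → List (Transition k n) → ℚ
  parses p w = ∑ (lifts p) (λ l → ind l w)

  parses-nonneg : ∀ p w → 0ℚ ≤ parses p w
  parses-nonneg p w = ∑-nonneg (lifts p) λ l _ → ind-nonneg l w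

  parses-≤1 : ∀ p w → parses p w ≤ 1ℚ
  parses-≤1 []      w = ℚ.≤-reflexive refl
  parses-≤1 (f ∷ p) w = subst (_≤ 1ℚ) (sym unfold) (∑-≤1 (fibre f) _ (fibre-unique f)
    (λ a _ → *-≤1 (ind-nonneg a w) (ind-≤1 a w) (parses-≤1 p _))
    λ a b a∈ b∈ a≢ b≢ → proj₁ (prefix-free-⊑ a∈ b∈ refl
      (ind-⋢ a w (*-≢0ˡ (parses p (drop (length a) w)) a≢))
      (ind-⋢ b w (*-≢0ˡ (parses p (drop (length b) w)) b≢))))
    where
    -- Sorting the lifts by their first chunk factorises the count; at most one first chunk is a
    -- prefix of `w`.
    unfold : parses (f ∷ p) w ≡ ∑ (fibre f) (λ a → ind a w * parses p (drop (length a) w))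
    unfold = trans (∑-lifts f p (λ l → ind l w)) (∑-cong (fibre f) λ a _ →
      trans (∑-cong (lifts p) λ b _ → ind-++ a b w) (∑-*ˡ (lifts p) (ind a w) _))

  parses-≢0 : ∀ p w → parses p w ≢ 0ℚ → ∃[ l ] l List.∈ lifts p × l ⊑ w
  parses-≢0 p w ne with l , l∈ , il≢0 ← ∑-≢0 (lifts p) _ ne = l , l∈ , ind-⋢ l w il≢0

  -- Turns the weight of a path of `M′` into an expectation in `M`, where it can be compared with
  -- weights of cylinders of `M`.
  E-parses : ∀ D {x p} → (∀ l → l List.∈ lifts p → PathFrom M (h x) l) → (∀ l → l List.∈ lifts p → length l ℕ.≤ D) →
             E D (h x) (parses p) ≡ pathProb M′ p
  E-parses D {x} {p} paths bound = trans (E-∑ D (h x) (lifts p) ind) (trans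
    (∑-cong (lifts p) λ l l∈ → E-ind D (h x) l (paths l l∈) (bound l l∈)) (lifts-prob p))

  -- The state of `M′` is carried along because `h` is not assumed injective, so that the path alone
  -- need not determine it.
  Start : Set
  Start = Σ[ x ∈ Fin n′ ] Σ[ π ∈ (ℕ → Transition k n) ] IsInfinitePath M π × src (π 0) ≡ h x

  firstEdge : Start → Transition k n′
  firstEdge (x , π , path , eq) = proj₁ (first-chunk x path eq)

  firstChunk : Start → List (Transition k n)
  firstChunk (x , π , path , eq) = proj₁ (proj₂ (proj₂ (first-chunk x path eq)))

  firstChunk∈ : ∀ σ → firstChunk σ List.∈ fibre (firstEdge σ)
  firstChunk∈ (x , π , path , eq) = proj₁ (proj₂ (proj₂ (proj₂ (first-chunk x path eq))))

  firstChunk⊑ω : ∀ σ → firstChunk σ ⊑ω proj₁ (proj₂ σ)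
  firstChunk⊑ω (x , π , path , eq) = proj₂ (proj₂ (proj₂ (proj₂ (first-chunk x path eq))))

  src-firstEdge : ∀ σ → src (firstEdge σ) ≡ proj₁ σ
  src-firstEdge (x , π , path , eq) = proj₁ (proj₂ (first-chunk x path eq))

  rest : Start → Start
  rest σ@(x , π , path , eq) =
    tgt (firstEdge σ) , shift (length l) π , IsInfinitePath-shift {M = M} {π} (length l) path , eq′
    where
    l = firstChunk σ
    eq′ : src (π (length l ℕ.+ 0)) ≡ h (tgt (firstEdge σ))
    eq′ = begin
      src (π (length l ℕ.+ 0))                   ≡⟨ cong (src ∘ π) (ℕ.+-identityʳ (length l)) ⟩
      src (π (length l))                         ≡⟨ endState-⊑ω {M = M} {l} {π} path (firstChunk⊑ω σ) ⟨
      endState (src (π 0)) l                     ≡⟨ cong (λ y → endState y l) eq ⟩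
      endState (h x) l                           ≡⟨ cong (λ y → endState (h y) l) (src-firstEdge σ) ⟨
      endState (h (src (firstEdge σ))) l         ≡⟨ fibre-end (firstChunk∈ σ) ⟩
      h (tgt (firstEdge σ))                      ∎
      where open ≡-Reasoning

  parse : Start → ℕ → Transition k n′
  parse σ zero    = firstEdge σ
  parse σ (suc i) = parse (rest σ) i

  parse-path : ∀ σ → IsInfinitePath M′ (parse σ)
  parse-path σ zero    = fibre⇒edge (firstChunk∈ σ) , sym (src-firstEdge (rest σ))
  parse-path σ (suc i) = parse-path (rest σ) i

  parse-lifts : ∀ σ d → ∃[ l ] l List.∈ lifts (applyUpTo (parse σ) d) × l ⊑ω proj₁ (proj₂ σ)
  parse-lifts σ zero    = [] , here refl , refl
  parse-lifts σ (suc d) with l , l∈ , q ← parse-lifts (rest σ) d =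
    firstChunk σ ++ l , ∈-lifts⁺ (firstEdge σ) (applyUpTo (parse (rest σ)) d) (firstChunk∈ σ) l∈ , ⊑ω-++⁺ {a = firstChunk σ} (firstChunk⊑ω σ) q

  chunk : Start → ℕ → List (Transition k n)
  chunk σ zero    = firstChunk σ
  chunk σ (suc i) = chunk (rest σ) i

  offset : Start → ℕ → ℕ
  offset σ zero    = 0
  offset σ (suc i) = length (firstChunk σ) ℕ.+ offset (rest σ) i

  chunk∈ : ∀ σ i → chunk σ i List.∈ fibre (parse σ i)
  chunk∈ σ zero    = firstChunk∈ σ
  chunk∈ σ (suc i) = chunk∈ (rest σ) i

  offset-suc : ∀ σ i → offset σ (suc i) ≡ offset σ i ℕ.+ length (chunk σ i)
  offset-suc σ zero    = ℕ.+-identityʳ _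
  offset-suc σ (suc i) = trans (cong (length (firstChunk σ) ℕ.+_) (offset-suc (rest σ) i))
    (sym (ℕ.+-assoc (length (firstChunk σ)) (offset (rest σ) i) _))

  chunk⊑ω : ∀ σ i → chunk σ i ⊑ω shift (offset σ i) (proj₁ (proj₂ σ))
  chunk⊑ω σ zero    = firstChunk⊑ω σ
  chunk⊑ω σ@(_ , π , _) (suc i) = ⊑ω-cong {l = chunk (rest σ) i}
    (λ j → cong π (sym (ℕ.+-assoc (length (firstChunk σ)) (offset (rest σ) i) j)))
    (chunk⊑ω (rest σ) i)

  -- Acceptance-preserving words are non-empty by definition. Hence the offsets increase strictly
  -- and the chunks exhaust the path.
  chunk-nonempty : ∀ σ i → 0 ℕ.< length (chunk σ i)
  chunk-nonempty σ i with chunk σ i | fibre-∼ (chunk∈ σ i)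
  ... | []    | t = ⊥-elim (AcceptancePreserving.nonempty (_∼_.preserving₁ t) refl)
  ... | _ ∷ _ | _ = s≤s z≤n

  offset-< : ∀ σ i → offset σ i ℕ.< offset σ (suc i)
  offset-< σ i rewrite offset-suc σ i = ℕ.m<m+n (offset σ i) (chunk-nonempty σ i)

  offset-mono : ∀ σ {i j} → i ℕ.≤ j → offset σ i ℕ.≤ offset σ j
  offset-mono σ {i} i≤j = go (ℕ.≤⇒≤′ i≤j)
    where
    go : ∀ {j} → i ℕ.≤′ j → offset σ i ℕ.≤ offset σ j
    go (ℕ.≤′-reflexive refl) = ℕ.≤-refl
    go {suc j} (ℕ.≤′-step p)       = ℕ.≤-trans (go p) (ℕ.<⇒≤ (offset-< σ j))

  offset-≥ : ∀ σ i → i ℕ.≤ offset σ i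
  offset-≥ σ zero    = z≤n
  offset-≥ σ (suc i) = ℕ.≤-trans (s≤s (offset-≥ σ i)) (offset-< σ i)

  -- The interval is open on the left and closed on the right because `run` at `j` is the position
  -- after `j` labels: it is reached by a non-empty prefix of chunk `i`, possibly by the whole
  -- chunk.
  locate : ∀ σ I j → offset σ I ℕ.< j →
           ∃[ i ] I ℕ.≤ i × offset σ i ℕ.< j × j ℕ.≤ offset σ (suc i)
  locate σ I j I<j with least j (j , ℕ.≤-refl , offset-≥ σ j)
  ... | zero  , j≤0 , _ = ⊥-elim (ℕ.<⇒≱ I<j (ℕ.≤-trans j≤0 z≤n))
  ... | suc i , j≤  , below = i , ℕ.≮⇒≥ I≮i , ℕ.≰⇒> (below i (ℕ.n<1+n i)) , j≤
    where
    I≮i : ¬ i ℕ.< I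
    I≮i i<I = ℕ.<⇒≱ I<j (ℕ.≤-trans j≤ (offset-mono σ i<I))

  -- Acceptance under decomposition

  module Acceptance (σ : Start) where
    private
      w : ℕ → Subset k
      w  = label ∘ proj₁ (proj₂ σ)
      w′ : ℕ → Subset k
      w′ = label ∘ parse σ
      o : ℕ → ℕ
      o = offset σ

      run-++ : ∀ i t → t ⊑ω shift i w → run A w (i ℕ.+ length t) ≡ Δ* A (run A w i) t
      run-++ i []      p = cong (run A w) (ℕ.+-identityʳ i)
      run-++ i (c ∷ t) p with p₁ , p₂ ← ⊑ω-tail {l = t} {shift i w} p = begin
        run A w (i ℕ.+ suc (length t))    ≡⟨ cong (run A w) (ℕ.+-suc i (length t)) ⟩
        run A w (suc i ℕ.+ length t)      ≡⟨ run-++ (suc i) t (⊑ω-cong {l = t} (λ j → cong w (ℕ.+-suc i j)) p₂) ⟩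
        Δ* A (Δ A (run A w i) (w i)) t    ≡⟨ cong (λ d → Δ* A (Δ A (run A w i) d) t)
                                               (trans (cong w (sym (ℕ.+-identityʳ i))) (sym p₁)) ⟩
        Δ* A (Δ A (run A w i) c) t        ∎
        where open ≡-Reasoning

      t : ℕ → List (Subset k)
      t i = trace (chunk σ i)

      t⊑ω : ∀ i → t i ⊑ω shift (o i) w
      t⊑ω i = trace-⊑ω {l = chunk σ i} (chunk⊑ω σ i)

      o-suc : ∀ i → o (suc i) ≡ o i ℕ.+ length (t i)
      o-suc i = trans (offset-suc σ i) (cong (o i ℕ.+_) (sym (List.length-map label (chunk σ i))))

      run-chunk : ∀ i → run A w (o (suc i)) ≡ Δ* A (run A w (o i)) (t i)
      run-chunk i = trans (cong (run A w) (o-suc i)) (run-++ (o i) (t i) (t⊑ω i))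

      -- Each chunk acts on positions as the label of its edge, so the run on `M′` is the run on `M`
      -- sampled at the chunk boundaries.
      run-o : ∀ i → run A w (o i) ≡ run A w′ i
      run-o zero    = refl
      run-o (suc i) = begin
        run A w (o (suc i))              ≡⟨ run-chunk i ⟩
        Δ* A (run A w (o i)) (t i)       ≡⟨ _∼_.same-action (fibre-∼ (chunk∈ σ i)) _ ⟩
        Δ A (run A w (o i)) (w′ i)       ≡⟨ cong (λ q → Δ A q (w′ i)) (run-o i) ⟩
        run A w′ (suc i)                 ∎
        where open ≡-Reasoning

      -- A visit inside a chunk happens after a non-empty prefix of its trace, so acceptance
      -- preservation carries it to the end of the chunk, where the sampled run sees it. The
      -- position itself may change; only membership in `Y` survives.
      visit : (Y : Subset m) →
        (∀ i q t′ → t′ ≢ [] → t′ ⊑ t i → Δ* A q t′ ∈ Y → Δ* A q (t i) ∈ Y) →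
        ∀ I j → o I ℕ.< j → run A w j ∈ Y → ∃[ i ] I ℕ.≤ i × run A w′ i ∈ Y
      visit Y preserved I j I<j ∈Y with i , I≤i , i<j , j≤ ← locate σ I j I<j
        = suc i , ℕ.m≤n⇒m≤1+n I≤i ,
          subst (_∈ Y) (trans (sym (run-chunk i)) (run-o (suc i)))
            (preserved i _ t′ t′≢[] t′⊑t (subst (_∈ Y) run-j ∈Y))
        where
        d = j ℕ.∸ o i
        o+d : o i ℕ.+ d ≡ j
        o+d = ℕ.m+[n∸m]≡n (ℕ.<⇒≤ i<j)
        t′ = applyUpTo (shift (o i) w) d
        t′-length : length t′ ≡ d
        t′-length = List.length-applyUpTo (shift (o i) w) d
        t′≢[] : t′ ≢ []
        t′≢[] eq = ℕ.<⇒≱ (ℕ.m<n⇒0<n∸m i<j)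
          (ℕ.≤-reflexive (trans (sym t′-length) (cong length eq)))
        d≤ : d ℕ.≤ length (t i)
        d≤ = subst (d ℕ.≤_) (ℕ.m+n∸m≡n (o i) _) (ℕ.∸-monoˡ-≤ (o i) (subst (j ℕ.≤_) (o-suc i) j≤))
        t′⊑ω : t′ ⊑ω shift (o i) w
        t′⊑ω = applyUpTo-⊑ω (shift (o i) w) d
        t′⊑t : t′ ⊑ t i
        t′⊑t = ⊑ω-⊑ t′⊑ω (t⊑ω i) (subst (ℕ._≤ length (t i)) (sym t′-length) d≤)
        run-j : run A w j ≡ Δ* A (run A w (o i)) t′
        run-j = trans (cong (run A w) (trans (sym o+d) (cong (o i ℕ.+_) (sym t′-length))))
                      (run-++ (o i) t′ t′⊑ω)

      preserving : ∀ i → AcceptancePreserving A (t i)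
      preserving i = _∼_.preserving₁ (fibre-∼ (chunk∈ σ i))

      -- Recovers a single recurring position, which `visit` loses: there are finitely many
      -- positions, so if each member of `Y` were eventually avoided, `Y` would be.
      recurrent : (Y : Subset m) (ρ : ℕ → Fin m) → (∀ i → ∃[ j ] i ℕ.≤ j × ρ j ∈ Y) →
                  ∃[ q ] q ∈ Y × InfinitelyOften A ρ q
      recurrent Y ρ often = byContradiction λ none →
        let I , bound = uniform (allFin m) (λ q I → q ∈ Y → ∀ j → I ℕ.≤ j → ρ j ≢ q)
              (λ I≤I′ f q∈ j I′≤j → f q∈ j (ℕ.≤-trans I≤I′ I′≤j))
              (λ q → byContradiction λ ¬bd → none (q , byContradiction (λ q∉ → ¬bd (0 , λ q∈ → ⊥-elim (q∉ q∈))) ,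
                 λ i → byContradiction λ ¬ex → ¬bd (i , λ _ j i≤j eq → ¬ex (j , i≤j , eq))))
            j , I≤j , ρj∈ = often I
        in bound (ρ j) (∈-allFin (ρ j)) ρj∈ j I≤j refl

      transient : (Y : Subset m) (ρ : ℕ → Fin m) → (∀ q → q ∈ Y → FinitelyOften A ρ q) →
                  ∃[ I ] ∀ j → I ℕ.≤ j → ¬ ρ j ∈ Y
      transient Y ρ finitely
        with I , bound ← uniform (allFin m) (λ q I → q ∈ Y → ∀ j → I ℕ.≤ j → ρ j ≢ q)
              (λ I≤I′ f q∈ j I′≤j → f q∈ j (ℕ.≤-trans I≤I′ I′≤j))
              (λ q → case decide′ (q ∈ Y) of λ where
                 (yes q∈) → let I , f = finitely q q∈ in I , λ _ → f
                 (no q∉)  → 0 , λ q∈ → ⊥-elim (q∉ q∈))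
        = I , λ j I≤j ρj∈ → bound (ρ j) (∈-allFin (ρ j)) ρj∈ j I≤j refl

    -- Visits to `L` are transported by `visit`, whereas avoidance of `U` is inherited by the
    -- sampled run. In `accepts⇐` the two arguments change places.
    accepts⇒ : Accepts A w → Accepts A w′
    accepts⇒ acc with (L , U) , LU∈ , (q , q∈ , often) , finitely ← List.find acc =
      List.lose LU∈ (recurrent L (run A w′) oftenL , finitely′)
      where
      oftenL : ∀ i → ∃[ j ] i ℕ.≤ j × run A w′ j ∈ L
      oftenL I with j , I≤j , eq ← often (suc (o I)) =
        visit L (λ i → AcceptancePreserving.L-preserved (preserving i) LU∈) I j I≤j
          (subst (_∈ L) (sym eq) q∈)
      finitely′ : ∀ q → q ∈ U → FinitelyOften A (run A w′) q
      finitely′ q q∈ with I , f ← finitely q q∈ = I , λ j I≤j eq →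
        f (o j) (ℕ.≤-trans I≤j (offset-≥ σ j)) (trans (run-o j) eq)

    accepts⇐ : Accepts A w′ → Accepts A w
    accepts⇐ acc with (L , U) , LU∈ , (q , q∈ , often) , finitely ← List.find acc =
      List.lose LU∈ ((q , q∈ , often′) , finitely′)
      where
      often′ : InfinitelyOften A (run A w) q
      often′ i with j , i≤j , eq ← often i =
        o j , ℕ.≤-trans i≤j (offset-≥ σ j) , trans (run-o j) eq
      finitely′ : ∀ q → q ∈ U → FinitelyOften A (run A w) q
      finitely′ q q∈ with I , none ← transient U (run A w′) finitely = suc (o I) , λ j I<j eq →
        let i , I≤i , ∈U = visit U (λ i → AcceptancePreserving.U-preserved (preserving i) LU∈) I j I<j
                             (subst (_∈ U) (sym eq) q∈)
        in none i I≤i ∈U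

  open Acceptance

  abstract
    decompose : ∀ {π} → IsInitialInfinitePath M π → ∃[ π′ ]
      IsInitialInfinitePath M′ π′ ×
      (∀ d → ∃[ l ] l List.∈ lifts (applyUpTo π′ d) × l ⊑ω π) ×
      (Accepts A (label ∘ π) ⇔ Accepts A (label ∘ π′))
    decompose {π} (path , start) =
      parse σ , (parse-path σ , src-firstEdge σ) , parse-lifts σ , mk⇔ (accepts⇒ σ) (accepts⇐ σ)
      where
      σ : Start
      σ = init M′ , π , path , trans start (sym h-init)

-- Transfer of covers

-- A `nothing` marks the end of each list. This padding keeps the recursion structural even when
-- many lists are empty, and stands for the empty set in a cover.
flatten : (ℕ → List X) → List X → ℕ → Maybe X
flatten L (x ∷ xs) zero    = just x
flatten L (x ∷ xs) (suc i) = flatten L xs i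
flatten L []       zero    = nothing
flatten L []       (suc i) = flatten (L ∘ suc) (L 0) i

flatten-head : ∀ (L : ℕ → List X) {x} xs → x List.∈ xs → ∃[ i ] flatten L xs i ≡ just x
flatten-head L (x ∷ xs) (here refl) = 0 , refl
flatten-head L (x ∷ xs) (there x∈) with i , eq ← flatten-head L xs x∈ = suc i , eq

flatten-complete : ∀ (L : ℕ → List X) {x} xs d → x List.∈ L d → ∃[ i ] flatten L xs i ≡ just x
flatten-complete L (x ∷ xs) d       x∈ with i , eq ← flatten-complete L xs d x∈ = suc i , eq
flatten-complete L []       zero    x∈ with i , eq ← flatten-head (L ∘ suc) (L 0) x∈ = suc i , eq
flatten-complete L []       (suc d) x∈ with i , eq ← flatten-complete (L ∘ suc) (L 0) d x∈ = suc i , eq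

-- A partial sum may stop inside a list; completing that list only adds non-negative terms.
flatten-sum : ∀ (v : X → ℚ) → (∀ x → 0ℚ ≤ v x) → ∀ (L : ℕ → List X) xs N →
  ∃[ D ] sumℚ (applyUpTo (λ i → maybe v 0ℚ (flatten L xs i)) N) ≤
         ∑ xs v + ∑ (concat (applyUpTo L D)) v
flatten-sum v nn L xs       zero    = 0 , subst (0ℚ ≤_) (sym (ℚ.+-identityʳ _)) (∑-nonneg xs λ x _ → nn x)
flatten-sum v nn L (x ∷ xs) (suc N) with D , le ← flatten-sum v nn L xs N =
  D , subst (v x + _ ≤_) (sym (ℚ.+-assoc (v x) _ _)) (ℚ.+-monoʳ-≤ (v x) le)
flatten-sum v nn L []       (suc N) with D , le ← flatten-sum v nn (L ∘ suc) (L 0) N =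
  suc D , ℚ.+-monoʳ-≤ 0ℚ (subst (_ ≤_) (sym (∑-++ (L 0) _ v)) le)

∑-concat-applyUpTo : ∀ (L : ℕ → List X) (v : X → ℚ) (f : ℕ → ℚ) → (∀ i → ∑ (L i) v ≡ f i) →
                     ∀ D → ∑ (concat (applyUpTo L D)) v ≡ sumℚ (applyUpTo f D)
∑-concat-applyUpTo L v f eq zero    = refl
∑-concat-applyUpTo L v f eq (suc D) = trans (∑-++ (L 0) _ v)
  (cong₂ _+_ (eq 0) (∑-concat-applyUpTo (L ∘ suc) v (f ∘ suc) (eq ∘ suc) D))

applyUpTo-⊑ω⇒≡ : ∀ {π ρ : ℕ → X} j → applyUpTo π j ⊑ω ρ → ∀ i → i ℕ.< j → π i ≡ ρ i
applyUpTo-⊑ω⇒≡ {π = π} {ρ} (suc j) p zero    _        = proj₁ (⊑ω-tail {l = applyUpTo (π ∘ suc) j} {ρ} p)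
applyUpTo-⊑ω⇒≡ {π = π} {ρ} (suc j) p (suc i) (s≤s lt) =
  applyUpTo-⊑ω⇒≡ j (proj₂ (⊑ω-tail {l = applyUpTo (π ∘ suc) j} {ρ} p)) i lt

module _ {k m : ℕ} (A : DRA k m) where

  run-cong : ∀ {w w′ : ℕ → Subset k} → (∀ i → w i ≡ w′ i) → ∀ i → run A w i ≡ run A w′ i
  run-cong eq zero    = refl
  run-cong eq (suc i) = cong₂ (Δ A) (run-cong eq i) (eq i)

  Accepts-cong : ∀ {w w′ : ℕ → Subset k} → (∀ i → w i ≡ w′ i) → Accepts A w → Accepts A w′
  Accepts-cong eq = Any.map λ ((q , q∈ , often) , finitely) →
    (q , q∈ , λ i → let j , i≤j , e = often i in j , i≤j , trans (sym (run-cong eq j)) e) ,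
    λ q q∈ → let I , f = finitely q q∈ in I , λ j I≤j e → f j I≤j (trans (run-cong eq j) e)

module _ {k n : ℕ} {M : Chain k n} where

  initial⇒PathFrom : (p : InitialPath M) → PathFrom M (init M) (proj₁ p)
  initial⇒PathFrom ([]    , _)             = []
  initial⇒PathFrom (e ∷ p , ip , Maybe.just refl) = IsPath⇒PathFrom ip

  PathFrom⇒initial : ∀ {l} → PathFrom M (init M) l → InitialPath M
  PathFrom⇒initial {[]}    p = [] , PathFrom⇒IsPath p , Maybe.nothing
  PathFrom⇒initial {e ∷ l} p = e ∷ l , PathFrom⇒IsPath p , Maybe.just (PathFrom-src p)

  proj₁-initial : ∀ {l} (p : PathFrom M (init M) l) → proj₁ (PathFrom⇒initial p) ≡ l
  proj₁-initial {[]}    p = refl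
  proj₁-initial {_ ∷ _} p = refl

  initialPaths : ∀ {ls} → All (PathFrom M (init M)) ls → List (InitialPath M)
  initialPaths = All.reduce PathFrom⇒initial

  proj₁-initialPaths : ∀ {ls} (ps : All (PathFrom M (init M)) ls) → map proj₁ (initialPaths ps) ≡ ls
  proj₁-initialPaths []       = refl
  proj₁-initialPaths (p ∷ ps) = cong₂ _∷_ (proj₁-initial p) (proj₁-initialPaths ps)

  ∈-initialPaths : ∀ {ls l} (ps : All (PathFrom M (init M)) ls) → l List.∈ ls →
                   ∃[ x ] x List.∈ initialPaths ps × l ≡ proj₁ x
  ∈-initialPaths ps l∈ = ∈-map⁻ proj₁ (subst (_ List.∈_) (sym (proj₁-initialPaths ps)) l∈)

  ∑-initialPaths : ∀ {ls} (ps : All (PathFrom M (init M)) ls) →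
                   ∑ (initialPaths ps) (pathProb M ∘ proj₁) ≡ ∑ ls (pathProb M)
  ∑-initialPaths ps = trans (sym (∑-map (initialPaths ps) proj₁ (pathProb M)))
    (cong (λ ls → ∑ ls (pathProb M)) (proj₁-initialPaths ps))

  initial-prefix : ∀ {π} → IsInitialInfinitePath M π → ∀ d → PathFrom M (init M) (applyUpTo π d)
  initial-prefix {π} (path , start) d =
    subst (λ x → PathFrom M x (applyUpTo π d)) start (⊑ω-PathFrom path (applyUpTo-⊑ω π d))

  -- Being an infinite path is a closed condition: its instance at `i` involves two consecutive
  -- edges, whence the prefix of length `suc (suc i)`.
  limit-path : ∀ {π : ℕ → Transition k n} →
    (∀ j → ∃[ ρ ] IsInfinitePath M ρ × applyUpTo π j ⊑ω ρ) → IsInfinitePath M π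
  limit-path {π} approx i with ρ , path , q ← approx (suc (suc i)) =
    subst₂ (λ e f → IsEdge M e × tgt e ≡ src f)
      (sym (applyUpTo-⊑ω⇒≡ {π = π} {ρ} (suc (suc i)) q i (ℕ.m<n⇒m<1+n (ℕ.n<1+n i))))
      (sym (applyUpTo-⊑ω⇒≡ {π = π} {ρ} (suc (suc i)) q (suc i) (ℕ.n<1+n (suc i))))
      (path i)

module Transfer (em : EM) {k m n n′ : ℕ} {A : DRA k m} {M : Chain k n} {M′ : Chain k n′}
                (mc : IsMarkovChain M) (R : Refinement A M M′) where
  open Refinement R
  open Markov M mc
  open Classical em
  open Refine em mc R

  AcceptedPath : ∀ {n} → Pred (ℕ → Transition k n) 0ℓ
  AcceptedPath π = Accepts A (label ∘ π)

  -- At a depth `D` that bounds all chunks from `x`, every path starts with exactly one chunk: at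
  -- most one by prefix-freeness, at least one by `first-chunk`. The expected number of such chunks
  -- is therefore one, and it is also the sum of the outgoing probabilities of `x` in `M′`.
  refined-markov : IsMarkovChain M′
  refined-markov = record { δ-nonneg = nonneg ; δ-≤1 = λ x c y →
      subst (prob M′ (x , c , y) ≤_) (sum≡1 x)
        (∑-∈-≤ (allSteps k n′) (λ (c , y) → prob M′ (x , c , y)) (λ (c , y) _ → nonneg x c y)
               (allSteps-complete c y))
    ; δ-sum = sum≡1 }
    where
    nonneg : ∀ x c y → 0ℚ ≤ prob M′ (x , c , y)
    nonneg x c y = subst (0ℚ ≤_) (sym (fibre-prob (x , c , y)))
      (∑-nonneg (fibre (x , c , y)) λ l _ → pathProb-nonneg l)

    module _ (x : Fin n′) where
      steps : List (Subset k × Fin n′)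
      steps = allSteps k n′

      bounded : ∃[ D ] ∀ l → l List.∈ concatMap (λ s → lifts [ x , s ]) steps → length l ℕ.≤ D
      bounded = length-bound _

      D : ℕ
      D = proj₁ bounded

      length≤D : ∀ {c y l} → l List.∈ lifts [ x , c , y ] → length l ℕ.≤ D
      length≤D {c} {y} l∈ = proj₂ bounded _
        (∈-concatMap⁺ (λ s → lifts [ x , s ]) (List.lose (allSteps-complete c y) l∈))

      paths : ∀ {f l} → l List.∈ lifts [ f ] → PathFrom M (h (src f)) l
      paths {f} l∈ with _ , _ , a∈ , _ ← ∈-lifts⁻ {f} {[]} l∈ = lifts-path (fibre⇒edge a∈ ∷ []) l∈

      total : List (Transition k n) → ℚ
      total w = ∑ steps (λ s → parses [ x , s ] w)

      total≤1 : ∀ w → total w ≤ 1ℚ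
      total≤1 w = ∑-≤1 steps _ (allSteps-unique k n′) (λ s _ → parses-≤1 [ x , s ] w) one
        where
        one : ∀ s s′ → s List.∈ steps → s′ List.∈ steps →
              parses [ x , s ] w ≢ 0ℚ → parses [ x , s′ ] w ≢ 0ℚ → s ≡ s′
        one s s′ _ _ ne ne′
          with l  , l∈  , l⊑w  ← parses-≢0 [ x , s ] w ne
             | l′ , l′∈ , l′⊑w ← parses-≢0 [ x , s′ ] w ne′
          with a  , _ , a∈  , _ , refl ← ∈-lifts⁻ {x , s} {[]} l∈
             | a′ , _ , a′∈ , _ , refl ← ∈-lifts⁻ {x , s′} {[]} l′∈
          with refl , refl ← prefix-free-⊑ a∈ a′∈ refl (++-⊑⁻ˡ a l⊑w) (++-⊑⁻ˡ a′ l′⊑w) = refl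

      total≥1 : ∀ w → PathFrom M (h x) w → length w ≡ D → 1ℚ ≤ total w
      total≥1 w pw len with π , path , start , w⊑π ← infinite-extension pw
        with (_ , c , y) , refl , l , l∈ , l⊑π ← first-chunk x path start =
        let l∈′ = ∈-lifts⁺ (x , c , y) [] l∈ (here refl)
            le  = ℕ.≤-trans (length≤D l∈′) (ℕ.≤-reflexive (sym len))
            l[]⊑w = ⊑ω-⊑ (subst (_⊑ω π) (sym (List.++-identityʳ l)) l⊑π) w⊑π le
        in ℚ.≤-trans (ℚ.≤-reflexive (sym (ind-⊑ l[]⊑w))) (ℚ.≤-trans
             (∑-∈-≤ (lifts [ x , c , y ]) (λ l → ind l w) (λ l _ → ind-nonneg l w) l∈′)
             (∑-∈-≤ steps (λ s → parses [ x , s ] w) (λ s _ → parses-nonneg [ x , s ] w)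
                    (allSteps-complete c y)))

      sum≡1 : ∑ steps (λ (c , y) → prob M′ (x , c , y)) ≡ 1ℚ
      sum≡1 = begin
        ∑ steps (λ s → prob M′ (x , s))
          ≡⟨ ∑-cong steps (λ s _ → trans (sym (ℚ.*-identityʳ _)) (sym (E-parses D {x} {[ x , s ]} (λ _ → paths) (λ _ → length≤D)))) ⟩
        ∑ steps (λ s → E D (h x) (parses [ x , s ]))
          ≡⟨ E-∑ D (h x) steps (λ s → parses [ x , s ]) ⟨
        E D (h x) total
          ≡⟨ E-cong D (h x) (λ w pw len → ℚ.≤-antisym (total≤1 w) (total≥1 w pw len)) ⟩
        E D (h x) (λ _ → 1ℚ)
          ≡⟨ E-const D (h x) 1ℚ ⟩
        1ℚ ∎
        where open ≡-Reasoning

  -- Pulling a cover back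

  module _ (C′ : CylinderSequence M′) where

    liftedPaths : (p : InitialPath M′) → All (PathFrom M (init M)) (lifts (proj₁ p))
    liftedPaths p = All.tabulate λ {l} l∈ →
      subst (λ x → PathFrom M x l) h-init (lifts-path (initial⇒PathFrom p) l∈)

    liftedCylinders : ℕ → List (InitialPath M)
    liftedCylinders i = maybe (λ p → initialPaths (liftedPaths p)) [] (C′ i)

    liftedCover : CylinderSequence M
    liftedCover = flatten liftedCylinders []

    lifted-weight : ∀ i → ∑ (liftedCylinders i) (pathProb M ∘ proj₁) ≡ cylinderMeasure M′ (C′ i)
    lifted-weight i with C′ i
    ... | nothing = refl
    ... | just p  = trans (∑-initialPaths (liftedPaths p)) (lifts-prob (proj₁ p))

    lifted-total : ∀ {q} → TotalAtMost M′ C′ q → TotalAtMost M liftedCover q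
    lifted-total total N with D , le ← flatten-sum (pathProb M ∘ proj₁) (λ p → pathProb-nonneg (proj₁ p))
                                          liftedCylinders [] N =
      ℚ.≤-trans le (ℚ.≤-trans (ℚ.≤-reflexive (trans (ℚ.+-identityˡ _)
        (∑-concat-applyUpTo liftedCylinders _ _ lifted-weight D))) (total D))

    lifted-covers : Covers M′ C′ AcceptedPath → Covers M liftedCover AcceptedPath
    lifted-covers covers π initial acc =
      let π′ , initial′ , parsed , accepts = decompose initial
          i , p , C′i , p⊑ = covers π′ initial′ (Equivalence.to accepts acc)
          l , l∈ , l⊑π = parsed (length (proj₁ p))
          x , x∈ , l≡ = ∈-initialPaths {l = l} (liftedPaths p) (subst (λ p → l List.∈ lifts p) (sym p⊑) l∈)
          j , found = flatten-complete liftedCylinders [] i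
             (subst (λ c → x List.∈ maybe (λ p → initialPaths (liftedPaths p)) [] c) (sym C′i) x∈)
      in j , x , found , subst (_⊑ω π) l≡ l⊑π

  -- Weight of an antichain whose lifts are covered

  module _ (ps : List (List (Transition k n′))) (unique : Unique ps)
    (paths : ∀ {p} → p List.∈ ps → PathFrom M′ (init M′) p)
    (antichain : ∀ {p p′} → p List.∈ ps → p′ List.∈ ps → p ⊑ p′ → p ≡ p′)
    (cs : List (Maybe (InitialPath M)))
    (cs-cover : ∀ {p} → p List.∈ ps → ∀ π → IsInitialInfinitePath M π → ∀ l → l List.∈ lifts p → l ⊑ω π →
                ∃[ x ] just x List.∈ cs × proj₁ x ⊑ω π) where
    private
      edges : Maybe (InitialPath M) → List (Transition k n)
      edges = maybe proj₁ []

      indC : Maybe (InitialPath M) → List (Transition k n) → ℚ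
      indC c w = maybe (λ p → ind (proj₁ p) w) 0ℚ c

      indC-nonneg : ∀ c w → 0ℚ ≤ indC c w
      indC-nonneg nothing  w = ℚ.≤-refl
      indC-nonneg (just p) w = ind-nonneg (proj₁ p) w

      bounded : ∃[ N ] ∀ l → l List.∈ concatMap lifts ps ++ map edges cs → length l ℕ.≤ N
      bounded = length-bound _

      N : ℕ
      N = proj₁ bounded

      lifts≤N : ∀ {p l} → p List.∈ ps → l List.∈ lifts p → length l ℕ.≤ N
      lifts≤N p∈ l∈ = proj₂ bounded _ (∈-++⁺ˡ (∈-concatMap⁺ lifts (List.lose p∈ l∈)))

      cs≤N : ∀ {c} → c List.∈ cs → length (edges c) ℕ.≤ N
      cs≤N c∈ = proj₂ bounded _ (∈-++⁺ʳ (concatMap lifts ps) (∈-map⁺ edges c∈))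

      E-indC : ∀ {c} → c List.∈ cs → E N (init M) (indC c) ≡ cylinderMeasure M c
      E-indC {nothing} c∈ = E-const N (init M) 0ℚ
      E-indC {just p}  c∈ = E-ind N (init M) (proj₁ p) (initial⇒PathFrom p) (cs≤N c∈)

      at-most-one : ∀ w p p′ → p List.∈ ps → p′ List.∈ ps →
                    parses p w ≢ 0ℚ → parses p′ w ≢ 0ℚ → p ≡ p′
      at-most-one w p p′ p∈ p′∈ ne ne′
        with l  , l∈  , l⊑w  ← parses-≢0 p w ne
           | l′ , l′∈ , l′⊑w ← parses-≢0 p′ w ne′
        with unique-parse (paths p∈) (paths p′∈) l∈ l′∈ l⊑w l′⊑w
      ... | inj₁ le = antichain p∈ p′∈ le
      ... | inj₂ le = sym (antichain p′∈ p∈ le)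

      covered : ∀ {p} w → p List.∈ ps → PathFrom M (init M) w → length w ≡ N → parses p w ≢ 0ℚ →
                1ℚ ≤ ∑ cs (λ c → indC c w)
      covered {p} w p∈ pw len ne =
        let l , l∈ , l⊑w = parses-≢0 p w ne
            π , path , start , w⊑π = infinite-extension pw
            x , x∈ , x⊑π = cs-cover p∈ π (path , start) l l∈ (⊑-⊑ω l⊑w w⊑π)
            x⊑w = ⊑ω-⊑ x⊑π w⊑π (ℕ.≤-trans (cs≤N x∈) (ℕ.≤-reflexive (sym len)))
        in ℚ.≤-trans (ℚ.≤-reflexive (sym (ind-⊑ x⊑w)))
                     (∑-∈-≤ cs (λ c → indC c w) (λ c _ → indC-nonneg c w) x∈)

      pointwise : ∀ w → PathFrom M (init M) w → length w ≡ N →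
                  ∑ ps (λ p → parses p w) ≤ ∑ cs (λ c → indC c w)
      pointwise w pw len with ∑ ps (λ p → parses p w) ℚ.≟ 0ℚ
      ... | yes eq = subst (_≤ _) (sym eq) (∑-nonneg cs λ c _ → indC-nonneg c w)
      ... | no ne = let p , p∈ , ne′ = ∑-≢0 ps _ ne in
        ℚ.≤-trans (∑-≤1 ps _ unique (λ p _ → parses-≤1 p w) (at-most-one w)) (covered w p∈ pw len ne′)

    -- At a depth `N` beyond all lifts and cylinders, the inequality holds path by path. Unique
    -- parsing makes the left side at most one, and if it is non-zero, then some cylinder in `cs`
    -- contains the path, so the right side is at least one. Taking expectations gives the weights.
    antichain-weight : ∑ ps (pathProb M′) ≤ ∑ cs (cylinderMeasure M)
    antichain-weight = begin
      ∑ ps (pathProb M′)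
        ≡⟨ ∑-cong ps (λ p p∈ → trans
             (sym (E-parses N {init M′} {p} (λ l l∈ → lifts-path (paths p∈) l∈) (λ l → lifts≤N p∈)))
             (cong (λ x → E N x (parses p)) h-init)) ⟩
      ∑ ps (λ p → E N (init M) (parses p))
        ≡⟨ E-∑ N (init M) ps parses ⟨
      E N (init M) (λ w → ∑ ps (λ p → parses p w))
        ≤⟨ E-mono N (init M) pointwise ⟩
      E N (init M) (λ w → ∑ cs (λ c → indC c w))
        ≡⟨ E-∑ N (init M) cs indC ⟩
      ∑ cs (λ c → E N (init M) (indC c))
        ≡⟨ ∑-cong cs (λ c c∈ → E-indC c∈) ⟩
      ∑ cs (cylinderMeasure M) ∎
      where open ℚ.≤-Reasoning

  -- The minimal paths of M′ all of whose lifts are covered by the members of C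
  -- with index below their length form an antichain, which covers the accepted
  -- paths of M′ by compactness and weighs no more than C.

  module _ (C : CylinderSequence M) where

    Hit : ℕ → Pred (ℕ → Transition k n) 0ℓ
    Hit d π = ∃[ i ] i ℕ.< d × ∃[ p ] C i ≡ just p × proj₁ p ⊑ω π

    Secured : ℕ → Pred (List (Transition k n′)) 0ℓ
    Secured d p = ∀ π → IsInitialInfinitePath M π → ∀ l → l List.∈ lifts p → l ⊑ω π → Hit d π

    module _ (covers : Covers M C AcceptedPath) (π′ : ℕ → Transition k n′)
             (initial′ : IsInitialInfinitePath M′ π′) (acc′ : AcceptedPath π′) where

      -- Counterexamples to `Secured d (applyUpTo π′ d)`. Letting `d` bound both the prefix of `π′`
      -- and the indices of the cylinders makes the family decreasing, as König's lemma requires.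
      Escaping : ℕ → Pred (ℕ → Transition k n) 0ℓ
      Escaping d π = IsInitialInfinitePath M π ×
        (∃[ l ] l List.∈ lifts (applyUpTo π′ d) × l ⊑ω π) × ¬ Hit d π

      Escaping-anti : ∀ {d d′ π} → d ℕ.≤ d′ → Escaping d′ π → Escaping d π
      Escaping-anti {d} {d′} d≤d′ (initial , (l , l∈ , l⊑π) , ¬hit)
        with l′ , l′∈ , l′⊑l ← lifts-⊑ (⊑ω⇒⊑ (subst (ℕ._≤ d′) (sym (List.length-applyUpTo π′ d)) d≤d′)
                                              (applyUpTo-⊑ω π′ d)) l∈
        = initial , (l′ , l′∈ , ⊑-⊑ω l′⊑l l⊑π) ,
          λ (i , i<d , hit) → ¬hit (i , ℕ.<-≤-trans i<d d≤d′ , hit)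

      module _ {π : ℕ → Transition k n}
               (approx : ∀ j d → ∃[ ρ ] Escaping d ρ × applyUpTo π j ⊑ω ρ) where
        private
          π-initial : IsInitialInfinitePath M π
          π-initial = limit-path {M = M} (λ j → let ρ , ((path , _) , _) , q = approx j 0 in ρ , path , q) , start
            where
            start : src (π 0) ≡ init M
            start with ρ , ((_ , ρ-start) , _) , q ← approx 1 0 =
              trans (cong src (applyUpTo-⊑ω⇒≡ {π = π} {ρ} 1 q 0 (s≤s z≤n))) ρ-start

          parsing = decompose π-initial

          π″ : ℕ → Transition k n′
          π″ = proj₁ parsing

          initial″ : IsInitialInfinitePath M′ π″
          initial″ = proj₁ (proj₂ parsing)

          -- The lifts of a finite prefix are finitely many, hence of length at most some `J`; an
          -- approximant that agrees with `π` on `J` edges passes its lift on to `π`.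
          π-lifts : ∀ d → ∃[ l ] l List.∈ lifts (applyUpTo π′ d) × l ⊑ω π
          π-lifts d with J , bound ← length-bound (lifts (applyUpTo π′ d))
            with ρ , (_ , (l , l∈ , l⊑ρ) , _) , q ← approx J d =
            l , l∈ , ⊑-⊑ω (⊑ω-⊑ l⊑ρ q (subst (length l ℕ.≤_) (sym (List.length-applyUpTo π J)) (bound l l∈)))
                          (applyUpTo-⊑ω π J)

          -- Prefixes of equal length of `π″` and `π′` both have lifts along `π`, so unique parsing
          -- makes them comparable and hence equal.
          π″≡π′ : ∀ i → π″ i ≡ π′ i
          π″≡π′ i with l , l∈ , l⊑ ← proj₁ (proj₂ (proj₂ parsing)) (suc i) | l′ , l′∈ , l′⊑ ← π-lifts (suc i) =
            applyUpTo-⊑ω⇒≡ {π = π″} {π′} (suc i) (subst (_⊑ω π′) (sym same) (applyUpTo-⊑ω π′ (suc i))) i (ℕ.n<1+n i)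
            where
            p  = applyUpTo π″ (suc i)
            p′ = applyUpTo π′ (suc i)
            len : length p ≡ length p′
            len = trans (List.length-applyUpTo π″ (suc i)) (sym (List.length-applyUpTo π′ (suc i)))
            pp : PathFrom M′ (init M′) p
            pp = initial-prefix initial″ (suc i)
            pp′ : PathFrom M′ (init M′) p′
            pp′ = initial-prefix initial′ (suc i)
            comparable : p ⊑ p′ ⊎ p′ ⊑ p
            comparable with ⊑ω-total l⊑ l′⊑
            ... | inj₁ le = unique-parse pp pp′ l∈ l′∈ le ⊑-refl
            ... | inj₂ le = unique-parse pp pp′ l∈ l′∈ ⊑-refl le
            same : p ≡ p′
            same with comparable
            ... | inj₁ le = ⊑-length-≡ le (ℕ.≤-reflexive (sym len))
            ... | inj₂ le = sym (⊑-length-≡ le (ℕ.≤-reflexive len))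

        -- The limit decomposes into the accepted `π′`, so it is accepted and lies in some cylinder
        -- of index `i`. An approximant that shares this cylinder and escapes at stage `suc i` is a
        -- contradiction.
        no-escape : ⊥
        no-escape with i , p , Ci , p⊑π ← covers π π-initial
                    (Equivalence.from (proj₂ (proj₂ (proj₂ parsing))) (Accepts-cong A (λ i → cong label (sym (π″≡π′ i))) acc′))
          with ρ , (_ , _ , ¬hit) , q ← approx (length (proj₁ p)) (suc i) =
          ¬hit (i , ℕ.n<1+n i , p , Ci , subst (_⊑ω ρ) (sym p⊑π) q)

      secured : ∃[ d ] Secured d (applyUpTo π′ d)
      secured = byContradiction λ none → no-escape (proj₂ (koenig (allTransitions k n) allTransitions-complete
        Escaping Escaping-anti λ d → byContradiction λ ¬esc → none (d , λ π initial l l∈ l⊑π → byContradiction λ ¬hit →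
          ¬esc (π , initial , (l , l∈ , l⊑π) , ¬hit))))

    NewlySecured : ℕ → Pred (List (Transition k n′)) 0ℓ
    NewlySecured d p = PathFrom M′ (init M′) p × Secured d p ×
      (∀ p′ → length p′ ℕ.< d → p′ ⊑ p → ¬ Secured (length p′) p′)

    level : ℕ → List (List (Transition k n′))
    level d = filter (λ p → decide′ (NewlySecured d p)) (allLists (allTransitions k n′) d)

    ∈-level⁻ : ∀ d {p} → p List.∈ level d → length p ≡ d × NewlySecured d p
    ∈-level⁻ d p∈ with p∈′ , new ← ∈-filter⁻ (λ p → decide′ (NewlySecured d p)) p∈ =
      allLists-length (allTransitions k n′) d p∈′ , new

    ∈-level⁺ : ∀ {d p} → length p ≡ d → NewlySecured d p → p List.∈ level d
    ∈-level⁺ {d} {p} refl new = ∈-filter⁺ (λ p → decide′ (NewlySecured d p))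
      (allLists-complete allTransitions-complete p) new

    level-paths : ∀ d → All (PathFrom M′ (init M′)) (level d)
    level-paths d = All.tabulate λ p∈ → proj₁ (proj₂ (∈-level⁻ d p∈))

    loweredCover : CylinderSequence M′
    loweredCover = flatten (λ d → initialPaths (level-paths d)) []

    lowered-covers : Covers M C AcceptedPath → Covers M′ loweredCover AcceptedPath
    lowered-covers covers π′ initial′ acc′ =
      let d₀ , sec₀ = secured covers π′ initial′ acc′
          d , sec , minimal = least {λ d → Secured d (applyUpTo π′ d)} d₀ (d₀ , ℕ.≤-refl , sec₀)
          x , x∈ , eq = ∈-initialPaths {l = applyUpTo π′ d} (level-paths d)
            (∈-level⁺ (List.length-applyUpTo π′ d)
              ( initial-prefix initial′ d
              , sec
              , λ p′ p′<d p′⊑ s → minimal (length p′) p′<d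
                  (subst (Secured (length p′)) (⊑-⊑ω p′⊑ (applyUpTo-⊑ω π′ d)) s)))
          i , found = flatten-complete (λ d → initialPaths (level-paths d)) [] d x∈
      in i , x , found , subst (_⊑ω π′) eq (applyUpTo-⊑ω π′ d)

    module _ (D : ℕ) where
      private
        chosen : List (List (Transition k n′))
        chosen = concat (applyUpTo level D)

        ∈-chosen⁻ : ∀ {p} → p List.∈ chosen → length p ℕ.< D × NewlySecured (length p) p
        ∈-chosen⁻ p∈ with ps , p∈ps , ps∈ ← ∈-concat⁻′ (applyUpTo level D) p∈
          with d , d<D , refl ← ∈-applyUpTo⁻ level ps∈
          with refl , new ← ∈-level⁻ d p∈ps = d<D , new

        chosen-unique : Unique chosen
        chosen-unique = Unique.concat⁺
          (All.applyUpTo⁺₂ level D λ d → Unique.filter⁺ _ (allLists-unique (allTransitions-unique k n′) d))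
          (AllPairs.applyUpTo⁺₁ level D λ {i} {j} i<j _ (p∈i , p∈j) →
            ℕ.<⇒≢ i<j (trans (sym (proj₁ (∈-level⁻ i p∈i))) (proj₁ (∈-level⁻ j p∈j))))

        chosen-antichain : ∀ {p p′} → p List.∈ chosen → p′ List.∈ chosen → p ⊑ p′ → p ≡ p′
        chosen-antichain {p} {p′} p∈ p′∈ p⊑p′ with length p ℕ.<? length p′
        ... | yes lt = ⊥-elim (proj₂ (proj₂ (proj₂ (∈-chosen⁻ p′∈))) p lt p⊑p′
                                      (proj₁ (proj₂ (proj₂ (∈-chosen⁻ p∈)))))
        ... | no nlt = ⊑-length-≡ p⊑p′ (ℕ.≮⇒≥ nlt)

        chosen-cover : ∀ {p} → p List.∈ chosen → ∀ π → IsInitialInfinitePath M π →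
          ∀ l → l List.∈ lifts p → l ⊑ω π → ∃[ x ] just x List.∈ applyUpTo C D × proj₁ x ⊑ω π
        chosen-cover p∈ π initial l l∈ l⊑π =
          let p<D , _ , sec , _ = ∈-chosen⁻ p∈
              i , i<p , x , Ci , x⊑π = sec π initial l l∈ l⊑π
          in x , subst (List._∈ applyUpTo C D) Ci (∈-applyUpTo⁺ C (ℕ.<-trans i<p p<D)) , x⊑π

      -- A path of length `d` below `D` is secured by cylinders of index below `d`, so the first `D`
      -- levels are paid for by the first `D` members of `C`.
      level-weight : sumℚ (applyUpTo (λ d → ∑ (level d) (pathProb M′)) D) ≤
                     sumℚ (applyUpTo (cylinderMeasure M ∘ C) D)
      level-weight = subst₂ _≤_
        (∑-concat-applyUpTo level (pathProb M′) (λ d → ∑ (level d) (pathProb M′)) (λ _ → refl) D)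
        (cong sumℚ (List.map-applyUpTo C (cylinderMeasure M) D))
        (antichain-weight chosen chosen-unique (λ p∈ → proj₁ (proj₂ (∈-chosen⁻ p∈))) chosen-antichain
                          (applyUpTo C D) chosen-cover)

    lowered-total : ∀ {q} → TotalAtMost M C q → TotalAtMost M′ loweredCover q
    lowered-total total N =
      let D , le = flatten-sum (pathProb M′ ∘ proj₁)
                     (λ x → Markov.pathProb-nonneg M′ refined-markov (proj₁ x))
                     (λ d → initialPaths (level-paths d)) [] N
      in ℚ.≤-trans le (ℚ.≤-trans (ℚ.≤-reflexive (trans (ℚ.+-identityˡ _)
           (∑-concat-applyUpTo (λ d → initialPaths (level-paths d)) (pathProb M′ ∘ proj₁)
              (λ d → ∑ (level d) (pathProb M′)) (λ d → ∑-initialPaths (level-paths d)) D)))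
           (ℚ.≤-trans (level-weight D) (total D)))

  satProb-refined : satProb M A ≈ᵣ satProb M′ A
  satProb-refined r = mk⇔
    (λ (q , q<r , C , covers , total) →
       q , q<r , loweredCover C , lowered-covers C covers , lowered-total C total)
    (λ (q , q<r , C′ , covers , total) →
       q , q<r , liftedCover C′ , lifted-covers C′ covers , lifted-total C′ total)

-- Deletion and replacement as refinements

listsUpTo : List X → ℕ → List (List X)
listsUpTo xs D = concat (applyUpTo (allLists xs) (suc D))

listsUpTo-complete : ∀ {xs : List X} → (∀ x → x List.∈ xs) → ∀ {D} l → length l ℕ.≤ D →
                     l List.∈ listsUpTo xs D
listsUpTo-complete {xs = xs} all l le =
  ∈-concat⁺′ (allLists-complete all l) (∈-applyUpTo⁺ (allLists xs) (s≤s le))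

listsUpTo-unique : ∀ {xs : List X} → Unique xs → ∀ D → Unique (listsUpTo xs D)
listsUpTo-unique {xs = xs} u D = Unique.concat⁺
  (All.applyUpTo⁺₂ (allLists xs) (suc D) (allLists-unique u))
  (AllPairs.applyUpTo⁺₁ (allLists xs) (suc D) λ {i} {j} i<j _ (∈i , ∈j) →
    ℕ.<⇒≢ i<j (trans (sym (allLists-length xs i ∈i)) (allLists-length xs j ∈j)))

module _ (em : EM) where

  -- The list returned is the one that `sumOver` itself selects, so the fibres built from it yield
  -- the same sums by `refl`.
  sumOver-finite : ∀ {P : Pred X 0ℓ} (xs : List X) → Unique xs → (∀ x → P x → x List.∈ xs) →
    Σ[ ys ∈ List X ] Unique ys × (∀ x → x List.∈ ys ⇔ P x) × (∀ f → sumOver em P f ≡ ∑ ys f)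
  sumOver-finite {X = X} {P = P} xs u complete
    with decide em (Σ[ ys ∈ List X ] Unique ys × (∀ x → x List.∈ ys ⇔ P x))
  ... | yes (ys , u′ , spec) = ys , u′ , spec , λ f → refl
  ... | no ¬finite = ⊥-elim (¬finite
    ( filter (decide em ∘ P) xs
    , Unique.filter⁺ (decide em ∘ P) u
    , λ x → mk⇔ (proj₂ ∘ ∈-filter⁻ (decide em ∘ P) {xs = xs})
                (λ p → ∈-filter⁺ (decide em ∘ P) {xs = xs} (complete x p) p)))

module _ {k m : ℕ} (A : DRA k m) where

  label-preserving : ∀ c → AcceptancePreserving A [ c ]
  label-preserving c = record
    { nonempty = λ ()
    ; L-preserved = λ _ q t ne t⊑ → subst (λ t → Δ* A q t ∈ _) (whole ne t⊑)
    ; U-preserved = λ _ q t ne t⊑ → subst (λ t → Δ* A q t ∈ _) (whole ne t⊑) }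
    where
    whole : ∀ {t} → t ≢ [] → t ⊑ [ c ] → t ≡ [ c ]
    whole ne []          = ⊥-elim (ne refl)
    whole ne (refl ∷ []) = refl

  label-∼ : ∀ c → _∼_ A [ c ] [ c ]
  label-∼ c = record
    { preserving₁ = label-preserving c ; preserving₂ = label-preserving c ; same-action = λ _ → refl }

  common-∼ : ∀ {t t₁ t₂} → _∼_ A t t₁ → _∼_ A t t₂ → _∼_ A t₁ t₂
  common-∼ r r′ = record
    { preserving₁ = _∼_.preserving₂ r ; preserving₂ = _∼_.preserving₂ r′
    ; same-action = λ q → trans (sym (_∼_.same-action r q)) (_∼_.same-action r′ q) }

module _ {k n : ℕ} (M : Chain k n) where

  -- Empty for a transition that is not an edge, because fibres may contain only paths; its
  -- probability, zero, is then the empty sum.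
  edgeChunk : Transition k n → List (List (Transition k n))
  edgeChunk e with 0ℚ ℚ.<? prob M e
  ... | yes _ = [ [ e ] ]
  ... | no  _ = []

  edgeChunk-∈⁺ : ∀ {e} → IsEdge M e → [ e ] List.∈ edgeChunk e
  edgeChunk-∈⁺ {e} edge with 0ℚ ℚ.<? prob M e
  ... | yes _   = here refl
  ... | no ¬edge = ⊥-elim (¬edge edge)

  edgeChunk-∈⁻ : ∀ {e l} → l List.∈ edgeChunk e → IsEdge M e × l ≡ [ e ]
  edgeChunk-∈⁻ {e} l∈ with 0ℚ ℚ.<? prob M e
  edgeChunk-∈⁻ {e} (here refl) | yes edge = edge , refl

  edgeChunk-unique : ∀ e → Unique (edgeChunk e)
  edgeChunk-unique e with 0ℚ ℚ.<? prob M e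
  ... | yes _ = [] ∷ []
  ... | no  _ = []

  edgeChunk-prob : ∀ e → 0ℚ ≤ prob M e → prob M e ≡ ∑ (edgeChunk e) (pathProb M)
  edgeChunk-prob e nonneg with 0ℚ ℚ.<? prob M e
  ... | yes _    = sym (trans (ℚ.+-identityʳ _) (ℚ.*-identityʳ _))
  ... | no ¬edge = ℚ.≤-antisym (ℚ.≮⇒≥ ¬edge) nonneg

  edgeChunk-path : ∀ {e l} → l List.∈ edgeChunk e → PathFrom M (src e) l
  edgeChunk-path {e} l∈ with edge , refl ← edgeChunk-∈⁻ {e} l∈ = edge ∷ []

module _ {k m n : ℕ} (A : DRA k m) (M : Chain k (suc n)) (mc : IsMarkovChain M)
         (s : Fin (suc n)) (s≢init : s ≢ init M)
         (no-incoming : ∀ e → IsEdge M e → tgt e ≢ s) where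
  private
    embed : Transition k n → Transition k (suc n)
    embed (x , c , y) = punchIn s x , c , punchIn s y

    embed-injective : ∀ {f g} → embed f ≡ embed g → f ≡ g
    embed-injective {x , c , y} {x′ , c′ , y′} eq = cong₂ _,_
      (Fin.punchIn-injective s x x′ (cong src eq))
      (cong₂ _,_ (cong label eq) (Fin.punchIn-injective s y y′ (cong tgt eq)))

    chunk-∈⁻ : ∀ {f l} → l List.∈ edgeChunk M (embed f) → IsEdge M (embed f) × l ≡ [ embed f ]
    chunk-∈⁻ {f} = edgeChunk-∈⁻ M {embed f}

  -- Since no edge enters `s`, a path that starts at another state never meets it, and each of its
  -- edges is a chunk by itself.
  delete-refinement : Refinement A M (delete M s s≢init)
  delete-refinement = record
    { h            = punchIn s
    ; h-init       = Fin.punchIn-punchOut s≢init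
    ; fibre        = edgeChunk M ∘ embed
    ; fibre-unique = edgeChunk-unique M ∘ embed
    ; fibre-path   = edgeChunk-path M
    ; fibre-end    = λ {f} l∈ → cong (endState (punchIn s (src f))) (proj₂ (chunk-∈⁻ {f} l∈))
    ; fibre-∼      = λ {f} l∈ → subst (λ l → _∼_ A (trace l) [ label f ]) (sym (proj₂ (chunk-∈⁻ {f} l∈)))
                                      (label-∼ A (label f))
    ; fibre-prob   = λ f → edgeChunk-prob M (embed f) (Markov.prob-nonneg M mc (embed f))
    ; prefix-free  = prefix-free
    ; first-chunk  = first-chunk
    }
    where
    prefix-free : ∀ {f g a b} → a List.∈ edgeChunk M (embed f) → b List.∈ edgeChunk M (embed g) →
                  src f ≡ src g → a ⊑ b → a ≡ b × f ≡ g
    prefix-free {f} {g} a∈ b∈ _ a⊑b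
      with _ , refl ← chunk-∈⁻ {f} a∈ | _ , refl ← chunk-∈⁻ {g} b∈
      with eq ∷ [] ← a⊑b = cong [_] eq , embed-injective eq

    first-chunk : ∀ {π} x → IsInfinitePath M π → src (π 0) ≡ punchIn s x →
      ∃[ f ] src f ≡ x × ∃[ l ] l List.∈ edgeChunk M (embed f) × l ⊑ω π
    first-chunk {π} x path start =
      f , refl , [ embed f ] , edgeChunk-∈⁺ M (subst (IsEdge M) (sym f≡) edge) , cong [_] f≡
      where
      edge = proj₁ (path 0)
      s≢y : s ≢ tgt (π 0)
      s≢y eq = no-incoming (π 0) edge (sym eq)
      f : Transition k n
      f = x , label (π 0) , punchOut s≢y
      f≡ : embed f ≡ π 0
      f≡ = cong₂ _,_ (sym start) (cong (label (π 0) ,_) (Fin.punchIn-punchOut s≢y))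

-- Structure of an MCCS

module MCCSProperties {k n m : ℕ} {A : DRA k m} {M : Chain k n} {e : Transition k n}
                      {T : Pred (List (Transition k n)) 0ℓ}
                      (e≢ : src e ≢ tgt e) (is : IsMCCS A M e T) where
  open IsMCCS is

  starts : ∀ {p} → T p → ∃[ q ] p ≡ e ∷ q × q ≢ []
  starts {p} t with paths p t
  ... | _ , refl ∷ [] = _ , refl , λ { refl → nontrivial t }

  T-path : ∀ {p} → T p → PathFrom M (src e) p
  T-path {p} t with q , refl , _ ← starts t = IsPath⇒PathFrom (proj₁ (paths p t))

  -- A proper prefix in `T` would be compatible with a label, which `minimal` forbids; its exception
  -- `[ e ]` is ruled out by `nontrivial`.
  antichain : ∀ {p p′} → T p → T p′ → p ⊑ p′ → p ≡ p′
  antichain {p} {p′} t t′ p⊑p′ with List.≡-dec _≟ₜ_ p p′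
  ... | yes eq = eq
  ... | no ne  = let _ , c , r = compatible p t in
    ⊥-elim (minimal p′ t′ p p⊑p′ ne (λ { refl → nontrivial t }) c r)

  -- The target of the leading `e` already accounts for the one permitted occurrence.
  no-return : ∀ {q g} → T (e ∷ q) → g List.∈ q → tgt g ≢ tgt e
  no-return {q} {g} t g∈ eq = ℕ.1+n≢0 (ℕ.suc-injective (trans (sym count) (tgt-once _ t)))
    where
    P? = tgt e Fin.≟_
    ∈rest : tgt e List.∈ filter P? (map tgt q)
    ∈rest = ∈-filter⁺ P? (subst (List._∈ map tgt q) eq (∈-map⁺ tgt g∈)) refl
    nonempty : ∀ {xs : List (Fin n)} → tgt e List.∈ xs → length xs ≡ suc (ℕ.pred (length xs))
    nonempty {_ ∷ _} _ = refl
    count : occurrences (tgt e) (e ∷ q) ≡ suc (suc (ℕ.pred (length (filter P? (map tgt q)))))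
    count = trans (cong length (trans
      (List.filter-reject P? (e≢ ∘ sym))
      (List.filter-accept P? {xs = map tgt q} refl))) (cong suc (nonempty ∈rest))

  -- As `[ e ]` is not in `T`, the path has a later edge, and its end is the target of one.
  T-end : ∀ {p} → T p → endState (src e) p ≢ tgt e
  T-end t with starts t
  ... | [] , refl , q≢[] = λ _ → q≢[] refl
  ... | g ∷ q , refl , _ = go g q λ h∈ → no-return t h∈
    where
    go : ∀ {z} (g : Transition k n) q → (∀ {h} → h List.∈ g ∷ q → tgt h ≢ z) →
         endState (tgt g) q ≢ z
    go g []      avoid = avoid (here refl)
    go g (h ∷ q) avoid = go h q (avoid ∘ there)

last-endState : ∀ {k n} (e : Transition k n) p →
                Maybe.map tgt (last (e ∷ p)) ≡ just (endState (tgt e) p)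
last-endState e []      = refl
last-endState e (f ∷ p) = last-endState f p

-- Replacement of a single edge

module Replacement (em : EM) {k n m : ℕ} (A : DRA k m) (M : Chain k n) (mc : IsMarkovChain M)
  (label-injective : ∀ (c₁ c₂ : Subset k) → _∼_ A [ c₁ ] [ c₂ ] → c₁ ≡ c₂)
  (e : Transition k n) (r : Replaceable A M e) where

  open Classical em
  open Markov M mc

  private
    T : Pred (List (Transition k n)) 0ℓ
    T = MCCS A M r

    e≢ : src e ≢ tgt e
    e≢ = proj₁ (proj₂ r)

    is : IsMCCS A M e T
    is = proj₂ (proj₂ (proj₂ r))

  open IsMCCS is
  open MCCSProperties e≢ is

  private
    M₁ : Chain k n
    M₁ = replace em A M e r

    Overlong : ℕ → Pred (ℕ → Transition k n) 0ℓ
    Overlong d ρ = (IsInfinitePath M ρ × ρ 0 ≡ e) × ∃[ p ] T p × p ⊑ω ρ × d ℕ.< length p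

    -- The limit starts with `e`, so some `t` in `T` is a prefix of it. An approximant that shares
    -- `t` but has a longer member of `T` as a prefix contradicts `antichain`. Thus `T` is bounded,
    -- hence finite.
    no-overlong-limit : ∀ {π} → ¬ (∀ j d → ∃[ ρ ] Overlong d ρ × applyUpTo π j ⊑ω ρ)
    no-overlong-limit {π} approx =
      let t , Tt , t⊑π = covering π
            (limit-path {M = M} λ j → let ρ , ((path , _) , _) , q = approx j 0 in ρ , path , q)
            (let ρ , ((_ , ρ0) , _) , q = approx 1 0 in
             trans (applyUpTo-⊑ω⇒≡ {π = π} {ρ} 1 q 0 (s≤s z≤n)) ρ0)
          ρ , (_ , p , Tp , p⊑ρ , t<p) , q = approx (length t) (length t)
          t⊑p = ⊑ω-⊑ (subst (_⊑ω ρ) (sym t⊑π) q) p⊑ρ (ℕ.<⇒≤ t<p)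
      in ℕ.<-irrefl (cong length (antichain Tt Tp t⊑p)) t<p

    abstract
      T-bounded : ∃[ D ] ∀ p → T p → length p ℕ.≤ D
      T-bounded = byContradiction λ unbounded → no-overlong-limit (proj₂ (koenig
        (allTransitions k n) allTransitions-complete Overlong
        (λ d≤d′ (path , p , Tp , p⊑ρ , lt) → path , p , Tp , p⊑ρ , ℕ.≤-<-trans d≤d′ lt)
        λ d → overlong d (¬∀⇒∃¬ λ short → unbounded (d , short))))
        where
        overlong : ∀ d → (∃[ p ] ¬ (T p → length p ℕ.≤ d)) → ∃[ ρ ] Overlong d ρ
        overlong d (p , long) =
          let Tp = byContradiction λ ¬Tp → long λ Tp → ⊥-elim (¬Tp Tp)
              π , path , _ , p⊑π = infinite-extension (T-path Tp)
              q , p≡ , _ = starts Tp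
          in π , (path , sym (proj₁ (⊑ω-tail {l = q} {π} (subst (_⊑ω π) p≡ p⊑π))))
               , p , Tp , p⊑π , ℕ.≰⇒> (λ le → long λ _ → le)

    T⟨_,_⟩ : Subset k → Fin n → Pred (List (Transition k n)) 0ℓ
    T⟨ c , y ⟩ p = T p × _∼_ A (trace p) [ c ] × Maybe.map tgt (last p) ≡ just y

    abstract
      T-finite : ∀ c y → Σ[ ps ∈ List (List (Transition k n)) ] Unique ps ×
        (∀ p → p List.∈ ps ⇔ T⟨ c , y ⟩ p) × (∀ f → sumOver em T⟨ c , y ⟩ f ≡ ∑ ps f)
      T-finite c y = sumOver-finite em (listsUpTo (allTransitions k n) (proj₁ T-bounded))
        (listsUpTo-unique (allTransitions-unique k n) (proj₁ T-bounded))
        (λ p (Tp , _) → listsUpTo-complete allTransitions-complete p (proj₂ T-bounded p Tp))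

    T-list : Subset k → Fin n → List (List (Transition k n))
    T-list c y = proj₁ (T-finite c y)

    T-list⁻ : ∀ {c y p} → p List.∈ T-list c y → T⟨ c , y ⟩ p
    T-list⁻ {c} {y} = Equivalence.to (proj₁ (proj₂ (proj₂ (T-finite c y))) _)

    T-list⁺ : ∀ {c y p} → T⟨ c , y ⟩ p → p List.∈ T-list c y
    T-list⁺ {c} {y} = Equivalence.from (proj₁ (proj₂ (proj₂ (T-finite c y))) _)

    T-target : ∀ {c y p} → T⟨ c , y ⟩ p → endState (src e) p ≡ y
    T-target (Tp , _ , last≡) with q , refl , _ ← starts Tp =
      Maybe.just-injective (trans (sym (last-endState e q)) last≡)

    -- The two decisions are arguments so that matching on them also reduces the nested `if` in the
    -- definition of `replace`.
    fibre? : ∀ f → Dec (f ≡ e) → Dec (src f ≡ src e) → List (List (Transition k n))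
    fibre? f (yes _) _       = []
    fibre? f (no  _) (yes _) = edgeChunk M f ++ T-list (label f) (tgt f)
    fibre? f (no  _) (no  _) = edgeChunk M f

    fibre : Transition k n → List (List (Transition k n))
    fibre f = fibre? f (f ≟ₜ e) (src f Fin.≟ src e)

    Chunk : Transition k n → List (Transition k n) → Set
    Chunk f l = f ≢ e × (IsEdge M f × l ≡ [ f ] ⊎ src f ≡ src e × T⟨ label f , tgt f ⟩ l)

    fibre?⁻ : ∀ {f l} d₁ d₂ → l List.∈ fibre? f d₁ d₂ → Chunk f l
    fibre?⁻ {f} (no f≢e) (yes eq) l∈ with ∈-++⁻ (edgeChunk M f) l∈
    ... | inj₁ ∈edge = f≢e , inj₁ (edgeChunk-∈⁻ M ∈edge)
    ... | inj₂ ∈T    = f≢e , inj₂ (eq , T-list⁻ ∈T)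
    fibre?⁻ (no f≢e) (no _) l∈ = f≢e , inj₁ (edgeChunk-∈⁻ M l∈)

    fibre?⁺ : ∀ {f l} d₁ d₂ → Chunk f l → l List.∈ fibre? f d₁ d₂
    fibre?⁺     (yes eq) _       (f≢e , _)                 = ⊥-elim (f≢e eq)
    fibre?⁺     (no _) (yes _)   (_ , inj₁ (edge , refl))  = ∈-++⁺ˡ (edgeChunk-∈⁺ M edge)
    fibre?⁺ {f} (no _) (yes _)   (_ , inj₂ (_ , t))        = ∈-++⁺ʳ (edgeChunk M f) (T-list⁺ t)
    fibre?⁺     (no _) (no _)    (_ , inj₁ (edge , refl))  = edgeChunk-∈⁺ M edge
    fibre?⁺     (no _) (no src≢) (_ , inj₂ (eq , _))       = ⊥-elim (src≢ eq)

    fibre⁻ : ∀ {f l} → l List.∈ fibre f → Chunk f l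
    fibre⁻ {f} = fibre?⁻ (f ≟ₜ e) (src f Fin.≟ src e)

    fibre⁺ : ∀ {f l} → Chunk f l → l List.∈ fibre f
    fibre⁺ {f} = fibre?⁺ (f ≟ₜ e) (src f Fin.≟ src e)

    fibre?-unique : ∀ f d₁ d₂ → Unique (fibre? f d₁ d₂)
    fibre?-unique f (yes _)  _       = []
    fibre?-unique f (no f≢e) (yes _) = Unique.++⁺ (edgeChunk-unique M f)
      (proj₁ (proj₂ (T-finite (label f) (tgt f)))) λ (∈edge , ∈T) →
        let _ , l≡[f] = edgeChunk-∈⁻ M {f} ∈edge
            _ , l≡e∷q , _ = starts (proj₁ (T-list⁻ ∈T))
        in f≢e (List.∷-injectiveˡ (trans (sym l≡[f]) l≡e∷q))
    fibre?-unique f (no _) (no _) = edgeChunk-unique M f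

    fibre?-prob : ∀ f (d₁ : Dec (f ≡ e)) (d₂ : Dec (src f ≡ src e)) →
      (if does d₁ then 0ℚ
       else if does d₂ then prob M f + sumOver em T⟨ label f , tgt f ⟩ (pathProb M)
       else prob M f) ≡ ∑ (fibre? f d₁ d₂) (pathProb M)
    fibre?-prob f (yes _) _       = refl
    fibre?-prob f (no _)  (yes _) = trans
      (cong₂ _+_ (edgeChunk-prob M f (prob-nonneg f))
                 (proj₂ (proj₂ (proj₂ (T-finite (label f) (tgt f)))) (pathProb M)))
      (sym (∑-++ (edgeChunk M f) _ (pathProb M)))
    fibre?-prob f (no _)  (no _)  = edgeChunk-prob M f (prob-nonneg f)

    chunk-path : ∀ {f l} → Chunk f l → PathFrom M (src f) l
    chunk-path (_ , inj₁ (edge , refl))      = edge ∷ []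
    chunk-path (_ , inj₂ (src≡ , Tl , _)) = subst (λ x → PathFrom M x _) (sym src≡) (T-path Tl)

    chunk-end : ∀ {f l} → Chunk f l → endState (src f) l ≡ tgt f
    chunk-end (_ , inj₁ (edge , refl)) = refl
    chunk-end {l = l} (_ , inj₂ (src≡ , t)) = trans (cong (λ x → endState x l) src≡) (T-target t)

    chunk-∼ : ∀ {f l} → Chunk f l → _∼_ A (trace l) [ label f ]
    chunk-∼ {f} (_ , inj₁ (edge , refl)) = label-∼ A (label f)
    chunk-∼ (_ , inj₂ (_ , _ , r , _))   = r

    -- Members of `T` start with `e`, which is not a chunk by itself, so the two kinds of chunk
    -- never compare. Two comparable members of `T` coincide, and then so do their labels, by
    -- injectivity, and their targets.
    chunk-prefix-free : ∀ {f g a b} → Chunk f a → Chunk g b → src f ≡ src g → a ⊑ b → a ≡ b × f ≡ g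
    chunk-prefix-free (_ , inj₁ (_ , refl)) (_ , inj₁ (_ , refl)) _ (refl ∷ []) = refl , refl
    chunk-prefix-free (f≢e , inj₁ (_ , refl)) (_ , inj₂ (_ , Tb , _)) _ a⊑b
      with _ , refl , _ ← starts Tb | f≡e ∷ [] ← a⊑b = ⊥-elim (f≢e f≡e)
    chunk-prefix-free (_ , inj₂ (_ , Ta , _)) (g≢e , inj₁ (_ , refl)) _ a⊑b
      with _ , refl , _ ← starts Ta | e≡g ∷ _ ← a⊑b = ⊥-elim (g≢e (sym e≡g))
    chunk-prefix-free (_ , inj₂ (_ , ta@(Ta , ra , _))) (_ , inj₂ (_ , tb@(Tb , rb , _))) src≡ a⊑b
      with refl ← antichain Ta Tb a⊑b =
      refl , cong₂ _,_ src≡ (cong₂ _,_ (label-injective _ _ (common-∼ A ra rb))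
                                       (trans (sym (T-target ta)) (T-target tb)))

    first-chunk : ∀ {π} x → IsInfinitePath M π → src (π 0) ≡ x →
                  ∃[ f ] src f ≡ x × ∃[ l ] Chunk f l × l ⊑ω π
    first-chunk {π} x path start with π 0 ≟ₜ e
    ... | no ≢e = π 0 , start , [ π 0 ] , (≢e , inj₁ (proj₁ (path 0) , refl)) , refl
    ... | yes ≡e =
      let p , Tp , p⊑π = covering π path ≡e
          _ , c , r = compatible p Tp
          y = endState (src e) p
          q , p≡ , _ = starts Tp
      in (src e , c , y) , trans (cong src (sym ≡e)) start , p
         , ( (λ f≡e → T-end Tp (cong tgt f≡e))
           , inj₂ (refl , Tp , r , subst (λ p → Maybe.map tgt (last p) ≡ just (endState (src e) p))
                                         (sym p≡) (last-endState e q)))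
         , p⊑π

  replace-refinement : Refinement A M M₁
  replace-refinement = record
    { h            = id
    ; h-init       = refl
    ; fibre        = fibre
    ; fibre-unique = λ f → fibre?-unique f (f ≟ₜ e) (src f Fin.≟ src e)
    ; fibre-path   = λ {f} l∈ → chunk-path (fibre⁻ {f} l∈)
    ; fibre-end    = λ {f} l∈ → chunk-end (fibre⁻ {f} l∈)
    ; fibre-∼      = λ {f} l∈ → chunk-∼ (fibre⁻ {f} l∈)
    ; fibre-prob   = λ f → fibre?-prob f (f ≟ₜ e) (src f Fin.≟ src e)
    ; prefix-free  = λ {f} {g} a∈ b∈ → chunk-prefix-free (fibre⁻ {f} a∈) (fibre⁻ {g} b∈)
    ; first-chunk  = λ x path start →
        let f , src≡ , l , ch , l⊑ = first-chunk x path start in f , src≡ , l , fibre⁺ {f} ch , l⊑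
    }

  private
    edge⁺ : ∀ {f} → f ≢ e → IsEdge M f → IsEdge M₁ f
    edge⁺ {f} f≢e edge = Refine.fibre⇒edge em mc replace-refinement {f} (fibre⁺ {f} (f≢e , inj₁ (edge , refl)))

    edge⁻ : ∀ {f} → IsEdge M₁ f → ∃[ l ] Chunk f l
    edge⁻ {f} edge =
      let l , l∈ , _ = ∑-positive (fibre f) (pathProb M) (λ l _ → pathProb-nonneg l)
                         (subst (0ℚ <_) (fibre?-prob f (f ≟ₜ e) (src f Fin.≟ src e)) edge)
      in l , fibre⁻ {f} l∈

  -- New edges end where members of `T` end, hence never at `tgt e`. So each replacement removes one
  -- edge into the state to be erased and adds none.
  edge-into-target : ∀ {f} → IsEdge M₁ f → tgt f ≡ tgt e → f ≢ e × IsEdge M f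
  edge-into-target {f} edge tgt≡ with edge⁻ {f} edge
  ... | _ , f≢e , inj₁ (edge′ , _) = f≢e , edge′
  ... | _ , f≢e , inj₂ (_ , t@(Tl , _)) = ⊥-elim (T-end Tl (trans (T-target t) tgt≡))

  -- A path in the MCCS of another edge f into tgt e cannot visit src e after
  -- its first edge, for it could then continue with e and return to tgt f.
  -- Hence the MCCS of f is unaffected by the replacement.
  module _ {f : Transition k n} (edge₁ : IsEdge M₁ f) (tgt≡ : tgt f ≡ tgt e)
           (rf : Replaceable A M f) where
    private
      Tf : Pred (List (Transition k n)) 0ℓ
      Tf = MCCS A M rf

      isf : IsMCCS A M f Tf
      isf = proj₂ (proj₂ (proj₂ rf))

      module F = IsMCCS isf
      module Fᵖ = MCCSProperties (proj₁ (proj₂ rf)) isf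

      avoids-source : ∀ {v} → PathFrom M (src f) (f ∷ v) → (∀ t → t ⊑ f ∷ v → ¬ Tf t) →
                      endState (tgt f) v ≢ src e
      avoids-source {v} path none ends
        with π , path∞ , start , w⊑π ← infinite-extension
               (PathFrom-++⁺ path (subst (λ x → PathFrom M x [ e ]) (sym ends) (proj₁ r ∷ [])))
        with t , Tt , t⊑π ← F.covering π path∞ (sym (proj₁ (⊑ω-tail {l = v ++ [ e ]} {π} w⊑π)))
        with length t ℕ.≤? length (f ∷ v)
      ... | yes le = none t (⊑ω-⊑ {π = π} t⊑π (⊑-⊑ω {π = π} ⊑-++ w⊑π) le) Tt
      ... | no nle with q , refl , _ ← Fᵖ.starts Tt
        -- Being longer than `f ∷ v`, the path `t` contains the appended `e`, which leads back to
        -- `tgt f`.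
        with refl ∷ v++e⊑q ← ⊑ω-⊑ {π = π} w⊑π t⊑π (ℕ.≤-trans
               (ℕ.≤-reflexive (trans (List.length-++ (f ∷ v)) (ℕ.+-comm _ 1))) (ℕ.≰⇒> nle))
        = Fᵖ.no-return Tt (⊑-∈ v++e⊑q (∈-++⁺ʳ v (here refl))) (sym tgt≡)
        where
        ⊑-∈ : ∀ {l w : List (Transition k n)} {x} → l ⊑ w → x List.∈ l → x List.∈ w
        ⊑-∈ (refl ∷ _) (here refl) = here refl
        ⊑-∈ (refl ∷ p) (there x∈)  = there (⊑-∈ p x∈)

      prefix-path : ∀ {π} → IsInfinitePath M₁ π → ∀ d → (∀ i → i ℕ.< d → IsEdge M (π i)) →
                    PathFrom M (src (π 0)) (applyUpTo π d)
      prefix-path path zero    edges = []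
      prefix-path {π} path (suc d) edges = edges 0 (s≤s z≤n) ∷
        subst (λ x → PathFrom M x (applyUpTo (π ∘ suc) d)) (sym (proj₂ (path 0)))
          (prefix-path {π ∘ suc} (λ i → path (suc i)) d (λ i i<d → edges (suc i) (s≤s i<d)))

      module _ {π : ℕ → Transition k n} (path : IsInfinitePath M₁ π) (π0≡f : π 0 ≡ f)
               (none : ∀ t → Tf t → ¬ t ⊑ω π) where

        -- New transitions of `M₁` leave `src e`, and `avoids-source` excludes that state while no
        -- member of `Tf` has been completed. So an uncovered path of `M₁` that starts with `f` is a
        -- path of `M`.
        next-edge : ∀ d → (∀ i → i ℕ.< d → IsEdge M (π i)) → IsEdge M (π d)
        next-edge zero    _     = subst (IsEdge M) (sym π0≡f) (proj₁ rf)
        next-edge (suc d) edges with edge⁻ {π (suc d)} (proj₁ (path (suc d)))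
        ... | _ , _ , inj₁ (edge , _) = edge
        ... | _ , _ , inj₂ (src≡ , _) = ⊥-elim (avoids-source w-path
                (λ t t⊑w Tt → none t Tt
                   (⊑-⊑ω (subst (λ g → t ⊑ g ∷ applyUpTo (π ∘ suc) d) (sym π0≡f) t⊑w)
                         (applyUpTo-⊑ω π (suc d))))
                (trans w-end src≡))
          where
          w-path : PathFrom M (src f) (f ∷ applyUpTo (π ∘ suc) d)
          w-path = subst (λ g → PathFrom M (src g) (g ∷ applyUpTo (π ∘ suc) d)) π0≡f
            (prefix-path {π} path (suc d) edges)
          w-end : endState (tgt f) (applyUpTo (π ∘ suc) d) ≡ src (π (suc d))
          w-end = trans
            (cong (λ x → endState x (applyUpTo (π ∘ suc) d))
                  (trans (cong tgt (sym π0≡f)) (proj₂ (path 0))))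
            (trans (endState-⊑ω {M = M₁} {applyUpTo (π ∘ suc) d} {π ∘ suc} (λ i → path (suc i))
                                (applyUpTo-⊑ω (π ∘ suc) d))
                   (cong (λ j → src (π (suc j))) (List.length-applyUpTo (π ∘ suc) d)))

        uncovered-edges : ∀ d i → i ℕ.< d → IsEdge M (π i)
        uncovered-edges (suc d) i (s≤s i≤d) with ℕ.m≤n⇒m<n∨m≡n i≤d
        ... | inj₁ i<d  = uncovered-edges d i i<d
        ... | inj₂ refl = next-edge d (uncovered-edges d)

      covering₁ : ∀ π → IsInfinitePath M₁ π → π 0 ≡ f → ∃[ p ] Tf p × p ⊑ω π
      covering₁ π path π0≡f = byContradiction λ none →
        none (F.covering π
          (λ i → uncovered-edges {π} path π0≡f (λ t Tt t⊑π → none (t , Tt , t⊑π)) (suc i) i (ℕ.n<1+n i)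
               , proj₂ (path i))
          π0≡f)

      paths₁ : ∀ p → Tf p → IsPath M₁ p × [ f ] ⊑ p
      paths₁ p Tp with q , refl , _ ← Fᵖ.starts Tp with ((_ ∷ edges) , linked) , f⊑ ← F.paths p Tp =
        -- After the first edge, `e` cannot occur, as it would return to `tgt f`; all other edges of
        -- `M` survive the replacement.
        ((edge₁ ∷ All.tabulate λ g∈ → edge⁺ (λ { refl → Fᵖ.no-return Tp g∈ (sym tgt≡) })
                                           (All.lookup edges g∈)) , linked) , f⊑

    still-replaceable : Replaceable A M₁ f
    still-replaceable = edge₁ , proj₁ (proj₂ rf) , Tf , record
      { paths = paths₁ ; covering = covering₁ ; compatible = F.compatible ; minimal = F.minimal
      ; nontrivial = F.nontrivial ; tgt-once = F.tgt-once }

≈ᵣ-trans : ∀ {x y z : Real} → x ≈ᵣ y → y ≈ᵣ z → x ≈ᵣ z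
≈ᵣ-trans p q r = mk⇔ (Equivalence.to (q r) ∘ Equivalence.to (p r))
                     (Equivalence.from (p r) ∘ Equivalence.from (q r))

-- Erasure

module _ (em : EM) {k n m : ℕ} (A : DRA k m)
  (label-injective : ∀ (c₁ c₂ : Subset k) → _∼_ A [ c₁ ] [ c₂ ] → c₁ ≡ c₂) (s : Fin n) where

  -- The loop invariant, with `es` still to be processed. For empty `es`, `incoming` says that no
  -- edge enters `s`, which is what deletion requires.
  record Erasing (M : Chain k n) (es : List (Transition k n)) : Set₁ where
    field
      markov      : IsMarkovChain M
      targets     : All (λ e → tgt e ≡ s) es
      incoming    : ∀ {f} → IsEdge M f → tgt f ≡ s → f List.∈ es
      replaceable : ∀ {f} → IsEdge M f → tgt f ≡ s → Replaceable A M f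

  replace-step : ∀ {M e es} → Erasing M (e ∷ es) →
    satProb M A ≈ᵣ satProb (replaceIfReplaceable em A M e) A ×
    Erasing (replaceIfReplaceable em A M e) es
  replace-step {M} {e} {es} inv with em {Replaceable A M e}
  ... | yes r = Transfer.satProb-refined em markov replace-refinement , record
      { markov      = Transfer.refined-markov em markov replace-refinement
      ; targets     = All.tail targets
      ; incoming    = λ edge tgt≡ → let f≢e , edge′ = edge-into-target edge (into tgt≡) in
                        tail≢ f≢e (incoming edge′ tgt≡)
      ; replaceable = λ edge tgt≡ → still-replaceable edge (into tgt≡)
                        (replaceable (proj₂ (edge-into-target edge (into tgt≡))) tgt≡) }
    where
    open Erasing inv
    open Replacement em A M markov label-injective e r
    into : ∀ {x} → x ≡ s → x ≡ tgt e
    into x≡s = trans x≡s (sym (All.head targets))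
    tail≢ : ∀ {f} → f ≢ e → f List.∈ e ∷ es → f List.∈ es
    tail≢ f≢e (here f≡e) = ⊥-elim (f≢e f≡e)
    tail≢ f≢e (there f∈) = f∈
  ... | no ¬r = (λ _ → mk⇔ id id) , record
      { markov = markov ; targets = All.tail targets ; replaceable = replaceable
      ; incoming = λ edge tgt≡ → case incoming edge tgt≡ of λ where
          -- Every edge into `s` is replaceable, so a skipped entry is not an edge of the current
          -- chain.
          (here refl) → ⊥-elim (¬r (replaceable edge tgt≡))
          (there f∈)  → f∈ }
    where open Erasing inv

  replaceAll-erases : ∀ {M} es → Erasing M es →
    satProb M A ≈ᵣ satProb (replaceAll em A M es) A × Erasing (replaceAll em A M es) []
  replaceAll-erases []       inv = (λ _ → mk⇔ id id) , inv
  replaceAll-erases (e ∷ es) inv =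
    let eq , inv′ = replace-step inv
        eq′ , inv″ = replaceAll-erases es inv′
    in ≈ᵣ-trans eq eq′ , inv″

∈-incomingEdges⁻ : ∀ {k n} (M : Chain k n) s {e} → e List.∈ incomingEdges M s → tgt e ≡ s
∈-incomingEdges⁻ {k} {n} M s e∈ =
  proj₂ (proj₂ (∈-filter⁻ (λ e → (0ℚ ℚ.<? prob M e) ×-dec (tgt e Fin.≟ s)) {xs = allTransitions k n} e∈))

∈-incomingEdges⁺ : ∀ {k n} (M : Chain k n) s {e} → IsEdge M e → tgt e ≡ s → e List.∈ incomingEdges M s
∈-incomingEdges⁺ M s {e} edge eq =
  ∈-filter⁺ (λ e → (0ℚ ℚ.<? prob M e) ×-dec (tgt e Fin.≟ s)) (allTransitions-complete e) (edge , eq)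

theorem27 : (em : EM) →
    ∀ {k n m : ℕ} (M : Chain k (suc n)) → IsMarkovChain M →
    (A : DRA k m) →
    (∀ (c₁ c₂ : Subset k) → _∼_ A [ c₁ ] [ c₂ ] → c₁ ≡ c₂) →
    (s : Fin (suc n)) (erasable : Erasable A M s) →
    satProb M A ≈ᵣ satProb (erase em A M s erasable) A
theorem27 em M mc A label-injective s erasable@(s≢init , replaceable) =
  let eq , erased = replaceAll-erases em A label-injective s (incomingEdges M s) record
        { markov      = mc
        ; targets     = All.tabulate (∈-incomingEdges⁻ M s)
        ; incoming    = ∈-incomingEdges⁺ M s
        ; replaceable = λ {f} → replaceable f }
      open Erasing erased
  in ≈ᵣ-trans eq
       (Transfer.satProb-refined em markov
         (delete-refinement A _ markov s _ λ e edge tgt≡s → case incoming edge tgt≡s of λ ()))
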